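{- For every $\delta>0$ there is $n_0$ such that for every $n\ge n_0$ the following holds. If $G$ is a spanning subgraph of the complete bipartite graph $K_{n,n}$ with minimum degree at least $\left(\frac{13}{16}+\delta\right)n$, then $\mathrm{tp}_2(G)\le 3$.
   Context: A $2$-colouring of a graph $G$ is an arbitrary colouring of the edges of $G$ with up to $2$ colours. A monochromatic tree is a subgraph of $G$ that is a tree all of whose edges have the same colour (a single vertex counts as a monochromatic tree). $\mathrm{tp}_2(G)$ is the smallest integer $k$ such that, in every $2$-colouring of $G$, the vertex set $V(G)$ can be partitioned into the vertex sets of at most $k$ monochromatic trees (pairwise vertex-disjoint; different trees may have different colours). -}

module Defs where

open import Data.Bool.Base using (Bool; true; false; T)
open import Data.Fin.Base using (Fin; splitAt)
open import Data.Fin.Subset using (Subset; Nonempty; _∈_; ∣_∣)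
open import Data.Integer.Base using (+_)
open import Data.List.Base using (_∷_; _∷ʳ_)
open import Data.List.Relation.Unary.Linked using (Linked)
open import Data.List.Relation.Unary.Unique.Propositional using (Unique)
open import Data.Nat.Base using (ℕ; _+_; _≤_)
open import Data.Product using (_×_; ∃; ∃-syntax; ∃!)
import Data.Rational.Base as ℚ
open import Data.Sum.Base using (_⊎_; inj₁; inj₂)
open import Data.Vec.Base using (tabulate)
open import Relation.Binary.Construct.Closure.ReflexiveTransitive using (Star)
open import Relation.Binary.PropositionalEquality using (_≡_; refl)
open import Relation.Nullary using (¬_)

record SimpleGraph (N : ℕ) : Set where
  field
    adj       : Fin N → Fin N → Bool
    symmetric : ∀ u v → adj u v ≡ adj v u
    loopless  : ∀ v → adj v v ≡ false

  Adj : Fin N → Fin N → Set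
  Adj u v = T (adj u v)

  neighbours : Fin N → Subset N
  neighbours v = tabulate (adj v)

  degree : Fin N → ℕ
  degree v = ∣ neighbours v ∣

open SimpleGraph public using (Adj; degree)

ℕ→ℚ : ℕ → ℚ.ℚ
ℕ→ℚ m = + m ℚ./ 1

MinDegreeAtLeast : ∀ {N} → SimpleGraph N → ℚ.ℚ → Set
MinDegreeAtLeast G d = ∀ v → d ℚ.≤ ℕ→ℚ (degree G v)

IsSpanningSubgraph : ∀ {N} → SimpleGraph N → SimpleGraph N → Set
IsSpanningSubgraph H G = ∀ {u v} → Adj H u v → Adj G u v

module _ {m n : ℕ} where

  opposite : Fin m ⊎ Fin n → Fin m ⊎ Fin n → Bool
  opposite (inj₁ _) (inj₁ _) = false
  opposite (inj₁ _) (inj₂ _) = true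
  opposite (inj₂ _) (inj₁ _) = true
  opposite (inj₂ _) (inj₂ _) = false

  opposite-sym : ∀ x y → opposite x y ≡ opposite y x
  opposite-sym (inj₁ _) (inj₁ _) = refl
  opposite-sym (inj₁ _) (inj₂ _) = refl
  opposite-sym (inj₂ _) (inj₁ _) = refl
  opposite-sym (inj₂ _) (inj₂ _) = refl

  opposite-irrefl : ∀ x → opposite x x ≡ false
  opposite-irrefl (inj₁ _) = refl
  opposite-irrefl (inj₂ _) = refl

-- The parts are the first m and the last n elements of Fin (m + n).
completeBipartite : ∀ m n → SimpleGraph (m + n)
completeBipartite m n = record
  { adj       = λ u v → opposite (splitAt m u) (splitAt m v)
  ; symmetric = λ u v → opposite-sym (splitAt m u) (splitAt m v)
  ; loopless  = λ v → opposite-irrefl (splitAt m v)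
  }

-- The edge set is a graph on all of Fin N whose edges have both ends in
-- `vertices`; by symmetry it is enough to require this of the first end.
record Subgraph {N : ℕ} (G : SimpleGraph N) : Set where
  field
    vertices : Subset N
    edges    : SimpleGraph N
    edges⊆G  : ∀ {u v} → Adj edges u v → Adj G u v
    ends     : ∀ {u v} → Adj edges u v → u ∈ vertices

open Subgraph public

-- A cycle x y z … x on at least three distinct vertices.
HasCycle : ∀ {N} → SimpleGraph N → Set
HasCycle G = ∃[ x ] ∃[ y ] ∃[ z ] ∃[ vs ]
  Unique (x ∷ y ∷ z ∷ vs) × Linked (Adj G) (x ∷ y ∷ z ∷ (vs ∷ʳ x))

record IsTree {N : ℕ} {G : SimpleGraph N} (H : Subgraph G) : Set where
  field
    nonempty  : Nonempty (vertices H)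
    connected : ∀ {u v} → u ∈ vertices H → v ∈ vertices H → Star (Adj (edges H)) u v
    acyclic   : ¬ HasCycle (edges H)

-- An edge uv is present as both (u , v) and (v , u), which get the same colour.
record 2-Colouring {N : ℕ} (G : SimpleGraph N) : Set where
  field
    colour     : ∀ {u v} → Adj G u v → Fin 2
    undirected : ∀ {u v} (e : Adj G u v) (e′ : Adj G v u) → colour e ≡ colour e′

open 2-Colouring public

Monochromatic : ∀ {N} {G : SimpleGraph N} → 2-Colouring G → Subgraph G → Set
Monochromatic χ H = ∃[ c ] ∀ {u v} (e : Adj (edges H) u v) → colour χ (edges⊆G H e) ≡ c

-- V(G) is partitioned by the vertex sets of j ≤ k monochromatic trees: each
-- vertex lies in exactly one of them.
record TreePartition {N : ℕ} {G : SimpleGraph N} (χ : 2-Colouring G) (k : ℕ) : Set where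
  field
    j             : ℕ
    j≤k           : j ≤ k
    part          : Fin j → Subgraph G
    tree          : ∀ i → IsTree (part i)
    monochromatic : ∀ i → Monochromatic χ (part i)
    partition     : ∀ v → ∃! _≡_ λ i → v ∈ vertices (part i)

AlwaysPartitionable : ∀ {N} → SimpleGraph N → ℕ → Set
AlwaysPartitionable G k = (χ : 2-Colouring G) → TreePartition χ k

-- IsTp₂ G k says tp₂(G) = k.
record IsTp₂ {N : ℕ} (G : SimpleGraph N) (k : ℕ) : Set where
  field
    partitionable : AlwaysPartitionable G k
    least         : ∀ l → AlwaysPartitionable G l → k ≤ l

tp₂[_]≤_ : ∀ {N} → SimpleGraph N → ℕ → Set
tp₂[ G ]≤ m = ∃[ k ] IsTp₂ G k × k ≤ m

{-# OPTIONS --safe #-}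
module Submission where

-- Let e bound the number of vertices of the opposite part that a vertex is not
-- adjacent to, and let w be a small multiple of n with 5e + 10w ≤ n.
-- Suppose x and y in the first part A have |M| ≥ e + 2w for M = N_k(x) ∩ N_l(y),
-- k and l being the two colours.  Then every a ∈ A has w neighbours in M in
-- colour k (a ∈ Ak) or in colour l (a ∈ Al), so a random split of M between a
-- k-tree at x and an l-tree at y attaches all of A, in whichever way the
-- vertices of Ak ∩ Al are distributed.  A random distribution also attaches
-- every b ∉ M except those with fewer than w k-neighbours in Ak and fewer than
-- w l-neighbours in Al.  Let z be one of these.  It has few neighbours in
-- Ak ∩ Al, so, up to exchanging the colours, Ak ∖ Al has about (n − e)/2 ≥ 2e
-- elements.  All exceptional b are joined in colour l to nearly all their
-- neighbours in Ak ∖ Al, so they share many l-neighbours with z there, and an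
-- l-tree at z that receives a random part of its neighbours in Ak ∖ Al covers
-- them.
-- If there is no such pair, take any x and the colour k more frequent at it:
-- every a ∈ A shares k-neighbours with x, and the same argument applies with
-- M = N_k(x), Ak = A and Al empty.

open import Defs
open import Data.Bool.Base using (Bool; true; false; T; not; _∧_; _∨_; if_then_else_)
open import Data.Bool.Properties using (¬-not; T-irrelevant; T-≡) renaming (_≟_ to _≟ᵇ_)
open import Data.Empty using (⊥; ⊥-elim)
open import Data.Fin.Base using (Fin; zero; suc; fromℕ<; splitAt; join; _↑ˡ_; _↑ʳ_)
open import Data.Fin.Properties using (_≟_; any?; all?; suc-injective; splitAt-join; join-splitAt; splitAt-↑ˡ; splitAt-↑ʳ)
open import Data.Fin.Subset using (Subset; _∈_; ∣_∣)
open import Data.Integer.Base as ℤ using (+_)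
import Data.Integer.Properties as ℤ
open import Data.List.Base using (List; []; _∷_; _∷ʳ_; map; length; tabulate)
import Data.List.Membership.Propositional as List
open import Data.List.Properties using (length-tabulate)
open import Data.List.Relation.Unary.All as All using (All; []; _∷_)
import Data.List.Relation.Unary.All.Properties as All
open import Data.List.Relation.Unary.AllPairs using (_∷_)
open import Data.List.Relation.Unary.Any using (Any; here; there)
open import Data.List.Relation.Unary.Linked as Linked using (Linked; _∷_)
open import Data.List.Relation.Unary.Unique.Propositional using (Unique)
open import Data.Maybe.Base using (Maybe; just; nothing)
open import Data.Maybe.Properties using (just-injective; ≡-dec)
open import Data.Nat.Base using (ℕ; zero; suc; _≤_; z≤n; s≤s; _^_; _∸_)
  renaming (_+_ to _+ℕ_; _*_ to _*ℕ_; _<_ to _<ℕ_; _/_ to _/ℕ_; _%_ to _%ℕ_)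
import Data.Nat.DivMod as ℕ
open import Data.Nat.ListAction using (sum)
open import Data.Nat.Properties as ℕ using (module ≤-Reasoning)
open import Data.Nat.Tactic.RingSolver using (solve-∀)
open import Data.Product using (Σ; _×_; _,_; proj₁; proj₂; ∃; ∃-syntax)
open import Data.Rational.Base as ℚ using (ℚ; 0ℚ; _<_; _+_; _*_; _/_; toℚᵘ)
import Data.Rational.Properties as ℚ
open import Data.Rational.Unnormalised.Base as ℚᵘ using (mkℚᵘ)
import Data.Rational.Unnormalised.Properties as ℚᵘ
open import Data.Sum.Base using (_⊎_; inj₁; inj₂; [_,_]′; swap)
open import Data.Unit.Base using (⊤; tt)
open import Data.Vec.Base as Vec using (Vec; []; _∷_; lookup)
import Data.Vec.Functional as F
open import Data.Vec.Properties using (lookup∘tabulate; lookup⇒[]=; []=⇒lookup)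
open import Function.Base using (_∘_; const; case_of_; id)
open import Function.Bundles using (mk⇔; Equivalence)
open import Relation.Binary.Construct.Closure.ReflexiveTransitive as Star using (Star; ε; _◅_; _◅◅_)
open import Relation.Binary.PropositionalEquality using (_≡_; _≢_; refl; sym; trans; cong; cong₂; subst)
open import Relation.Nullary.Decidable
  using (Dec; yes; no; does; dec-true; dec-false; _×-dec_; _⊎-dec_; does-⇔; map′; ¬?; decidable-stable)
open import Relation.Nullary.Negation using (¬_)

-- Counting in finite sets.

bit : Bool → ℕ
bit b = if b then 1 else 0

bit-mono : ∀ {a b} → (a ≡ true → b ≡ true) → bit a ≤ bit b
bit-mono {false} _ = z≤n
bit-mono {true}  f rewrite f refl = ℕ.≤-refl

count : ∀ {n} → (Fin n → Bool) → ℕ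
count {zero}  S = 0
count {suc n} S = bit (S zero) +ℕ count (S ∘ suc)

count-⊆ : ∀ {n} {S R : Fin n → Bool} → (∀ i → S i ≡ true → R i ≡ true) → count S ≤ count R
count-⊆ {zero}          S⊆R = z≤n
count-⊆ {suc n} {S} {R} S⊆R = ℕ.+-mono-≤ (bit-mono (S⊆R zero)) (count-⊆ (S⊆R ∘ suc))

count-⊂ : ∀ {n} {S R : Fin n → Bool} → (∀ i → S i ≡ true → R i ≡ true) →
          ∀ i → S i ≡ false → R i ≡ true → count S <ℕ count R
count-⊂ {S = S} {R} S⊆R zero    i∉S i∈R rewrite i∉S | i∈R = s≤s (count-⊆ (S⊆R ∘ suc))
count-⊂ {S = S} {R} S⊆R (suc i) i∉S i∈R =
  ℕ.+-mono-≤-< (bit-mono (S⊆R zero)) (count-⊂ (S⊆R ∘ suc) i i∉S i∈R)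

count-all : ∀ n → count {n} (const true) ≡ n
count-all zero    = refl
count-all (suc n) = cong suc (count-all n)

count-none : ∀ {n} {S : Fin n → Bool} → (∀ i → S i ≡ true → ⊥) → count S ≡ 0
count-none {zero}      none = refl
count-none {suc n} {S} none with S zero in eq
... | true  = ⊥-elim (none zero eq)
... | false = count-none (none ∘ suc)

count-∃ : ∀ {n} {S : Fin n → Bool} → 1 ≤ count S → ∃[ i ] S i ≡ true
count-∃ {suc n} {S} 1≤ with S zero in eq
... | true  = zero , eq
... | false with i , i∈S ← count-∃ 1≤ = suc i , i∈S

count-single : ∀ {n} (x : Fin n) → count (λ i → does (i ≟ x)) ≤ 1
count-single {suc n} zero    = ℕ.≤-reflexive (cong suc (count-none {n} {λ i → does (suc i ≟ zero)} λ _ ()))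
count-single (suc x) = count-single x

count-∨ : ∀ {n} (S R : Fin n → Bool) → count (λ i → S i ∨ R i) ≤ count S +ℕ count R
count-∨ {zero}  S R = z≤n
count-∨ {suc n} S R = begin
  bit (S zero ∨ R zero) +ℕ count (λ i → S (suc i) ∨ R (suc i))
    ≤⟨ ℕ.+-mono-≤ (bit-∨ (S zero) (R zero)) (count-∨ (S ∘ suc) (R ∘ suc)) ⟩
  (bit (S zero) +ℕ bit (R zero)) +ℕ (count (S ∘ suc) +ℕ count (R ∘ suc))
    ≡⟨ interchange (bit (S zero)) _ _ _ ⟩
  count S +ℕ count R ∎
  where
  open ≤-Reasoning
  bit-∨ : ∀ a b → bit (a ∨ b) ≤ bit a +ℕ bit b
  bit-∨ false b = ℕ.≤-refl
  bit-∨ true  b = s≤s z≤n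
  interchange : ∀ a b c d → (a +ℕ b) +ℕ (c +ℕ d) ≡ (a +ℕ c) +ℕ (b +ℕ d)
  interchange = solve-∀

-- The union bound. Most size estimates below apply it to an explicit list of covering sets.
count-cover : ∀ {n} (Rs : List (Fin n → Bool)) {S : Fin n → Bool} →
              (∀ i → S i ≡ true → Any (λ R → R i ≡ true) Rs) → count S ≤ sum (map count Rs)
count-cover []       {S} cover = ℕ.≤-reflexive (count-none λ i i∈S → case cover i i∈S of λ ())
count-cover (R ∷ Rs) {S} cover = begin
  count S                                   ≤⟨ count-⊆ S⊆ ⟩
  count (λ i → R i ∨ (S i ∧ not (R i)))     ≤⟨ count-∨ R _ ⟩
  count R +ℕ count (λ i → S i ∧ not (R i))  ≤⟨ ℕ.+-monoʳ-≤ (count R) (count-cover Rs rest) ⟩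
  count R +ℕ sum (map count Rs)             ∎
  where
  open ≤-Reasoning
  S⊆ : ∀ i → S i ≡ true → R i ∨ (S i ∧ not (R i)) ≡ true
  S⊆ i i∈S rewrite i∈S with R i
  ... | true  = refl
  ... | false = refl
  rest : ∀ i → S i ∧ not (R i) ≡ true → Any (λ R′ → R′ i ≡ true) Rs
  rest i i∈ with S i in i∈S | R i in i∈R
  rest i i∈ | true | false with cover i i∈S
  ... | there p = p
  ... | here  p with () ← trans (sym p) i∈R

-- Satisfying clauses on large sets.

Clause : ℕ → Set
Clause n = Bool × (Fin n → Bool)

Satisfies : ∀ {n} → (Fin n → Bool) → Clause n → Set
Satisfies g (p , S) = ∃[ i ] S i ≡ true × g i ≡ p

-- This is 2 to the power n - |S|, the number of assignments that take the wrong value on all of S.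
-- The recursion avoids truncated subtraction.
falsifiers : ∀ {n} → (Fin n → Bool) → ℕ
falsifiers {zero}  S = 1
falsifiers {suc n} S = (if S zero then 1 else 2) *ℕ falsifiers (S ∘ suc)

falsifiers-count : ∀ {n} (S : Fin n → Bool) → falsifiers S *ℕ 2 ^ count S ≡ 2 ^ n
falsifiers-count {zero}  S = refl
falsifiers-count {suc n} S with S zero
... | true  = trans (shift (falsifiers (S ∘ suc)) _) (cong (2 *ℕ_) (falsifiers-count (S ∘ suc)))
  where
  shift : ∀ a b → (1 *ℕ a) *ℕ (2 *ℕ b) ≡ 2 *ℕ (a *ℕ b)
  shift = solve-∀
... | false = trans (ℕ.*-assoc 2 (falsifiers (S ∘ suc)) _) (cong (2 *ℕ_) (falsifiers-count (S ∘ suc)))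

total : ∀ {n} → List (Clause n) → ℕ
total cs = sum (map (falsifiers ∘ proj₂) cs)

restrict : ∀ {n} → Bool → List (Clause (suc n)) → List (Clause n)
restrict b []             = []
restrict b ((p , S) ∷ cs) with S zero | p ≟ᵇ b
... | true  | yes _ = restrict b cs
... | true  | no  _ = (p , S ∘ suc) ∷ restrict b cs
... | false | _     = (p , S ∘ suc) ∷ restrict b cs

-- The falsifiers of a clause are sorted by their first value: if the clause contains the first
-- variable, all of them lie on one side, otherwise half of them on each.
restrict-total : ∀ {n} (cs : List (Clause (suc n))) →
                 total (restrict true cs) +ℕ total (restrict false cs) ≡ total cs
restrict-total []             = refl
restrict-total ((p , S) ∷ cs) with S zero | p | restrict-total cs
... | true  | true  | eq =
  trans (lemma (falsifiers (S ∘ suc)) (total (restrict true cs)) _) (cong (1 *ℕ falsifiers (S ∘ suc) +ℕ_) eq)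
  where
  lemma : ∀ f a b → a +ℕ (f +ℕ b) ≡ 1 *ℕ f +ℕ (a +ℕ b)
  lemma = solve-∀
... | true  | false | eq =
  trans (lemma (falsifiers (S ∘ suc)) (total (restrict true cs)) _) (cong (1 *ℕ falsifiers (S ∘ suc) +ℕ_) eq)
  where
  lemma : ∀ f a b → (f +ℕ a) +ℕ b ≡ 1 *ℕ f +ℕ (a +ℕ b)
  lemma = solve-∀
... | false | _     | eq =
  trans (lemma (falsifiers (S ∘ suc)) (total (restrict true cs)) _) (cong (2 *ℕ falsifiers (S ∘ suc) +ℕ_) eq)
  where
  lemma : ∀ f a b → (f +ℕ a) +ℕ (f +ℕ b) ≡ 2 *ℕ f +ℕ (a +ℕ b)
  lemma = solve-∀

restrict-satisfies : ∀ {n} b {g : Fin n → Bool} (cs : List (Clause (suc n))) →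
                     All (Satisfies g) (restrict b cs) → All (Satisfies (b F.∷ g)) cs
restrict-satisfies b []             sat = []
restrict-satisfies b ((p , S) ∷ cs) sat with S zero in eq | p ≟ᵇ b
... | true  | yes refl = (zero , eq , refl) ∷ restrict-satisfies b cs sat
restrict-satisfies b ((p , S) ∷ cs) ((i , s) ∷ sat) | true  | no  _ = (suc i , s) ∷ restrict-satisfies b cs sat
restrict-satisfies b ((p , S) ∷ cs) ((i , s) ∷ sat) | false | _     = (suc i , s) ∷ restrict-satisfies b cs sat

-- The method of conditional expectations: one of the two values of the first
-- variable leaves at most half of the falsifiers.
satisfiable : ∀ {n} (cs : List (Clause n)) → total cs <ℕ 2 ^ n → ∃[ g ] All (Satisfies g) cs
satisfiable {zero}  []       _          = (λ ()) , []
-- A clause left without variables has one falsifier, which already reaches 2 ^ 0.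
satisfiable {zero}  (_ ∷ _)  (s≤s ())
satisfiable {suc n} cs       lt with total (restrict true cs) ℕ.<? 2 ^ n
... | yes lt₁ = let g , sat = satisfiable (restrict true cs) lt₁ in true F.∷ g , restrict-satisfies true cs sat
... | no  ge  = let g , sat = satisfiable (restrict false cs) lt₂ in false F.∷ g , restrict-satisfies false cs sat
  where
  open ≤-Reasoning
  lt₂ : total (restrict false cs) <ℕ 2 ^ n
  lt₂ = ℕ.+-cancelˡ-< (2 ^ n) _ _ (begin-strict
    2 ^ n +ℕ total (restrict false cs)                      ≤⟨ ℕ.+-monoˡ-≤ _ (ℕ.≮⇒≥ ge) ⟩
    total (restrict true cs) +ℕ total (restrict false cs)   ≡⟨ restrict-total cs ⟩
    total cs                                                <⟨ lt ⟩
    2 ^ n +ℕ (2 ^ n +ℕ 0)                                   ≡⟨ cong (2 ^ n +ℕ_) (ℕ.+-identityʳ _) ⟩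
    2 ^ n +ℕ 2 ^ n                                          ∎)

-- A clause on at least w variables fails with probability at most 2 ^ (- w); the estimate is
-- multiplied out to stay in ℕ.
total-width : ∀ {n w} (cs : List (Clause n)) → All (λ c → w ≤ count (proj₂ c)) cs →
              total cs *ℕ 2 ^ w ≤ length cs *ℕ 2 ^ n
total-width         []             []           = z≤n
total-width {n} {w} ((p , S) ∷ cs) (wide ∷ all) = begin
  (falsifiers S +ℕ total cs) *ℕ 2 ^ w            ≡⟨ ℕ.*-distribʳ-+ (2 ^ w) (falsifiers S) _ ⟩
  falsifiers S *ℕ 2 ^ w +ℕ total cs *ℕ 2 ^ w     ≤⟨ ℕ.+-mono-≤ (ℕ.*-monoʳ-≤ (falsifiers S) (ℕ.^-monoʳ-≤ 2 wide)) (total-width cs all) ⟩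
  falsifiers S *ℕ 2 ^ count S +ℕ length cs *ℕ 2 ^ n ≡⟨ cong (_+ℕ length cs *ℕ 2 ^ n) (falsifiers-count S) ⟩
  2 ^ n +ℕ length cs *ℕ 2 ^ n                    ∎
  where open ≤-Reasoning

-- Stands in for every random split: a clause asks for an element of a large set
-- to be put on a prescribed side.
splitting : ∀ {m n w} → m <ℕ 2 ^ w → (c : Fin m → Clause n) → (∀ i → w ≤ count (proj₂ (c i))) →
            ∃[ g ] ∀ i → Satisfies g (c i)
splitting {m} {n} {w} m<2^w c wide = let g , sat = satisfiable (tabulate c) small in g , All.tabulate⁻ sat
  where
  open ≤-Reasoning
  small : total (tabulate c) <ℕ 2 ^ n
  small = ℕ.*-cancelʳ-< (2 ^ w) _ _ (begin-strict
    total (tabulate c) *ℕ 2 ^ w   ≤⟨ total-width (tabulate c) (All.tabulate⁺ wide) ⟩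
    length (tabulate c) *ℕ 2 ^ n  ≡⟨ cong (_*ℕ 2 ^ n) (length-tabulate c) ⟩
    m *ℕ 2 ^ n                    <⟨ ℕ.*-monoˡ-< (2 ^ n) {{ℕ.m^n≢0 2 n}} m<2^w ⟩
    2 ^ w *ℕ 2 ^ n                ≡⟨ ℕ.*-comm (2 ^ w) (2 ^ n) ⟩
    2 ^ n *ℕ 2 ^ w                ∎)

-- Partitions into monochromatic connected classes.

module _ {V : Set} (hue : Fin 2 → V → V → Bool) {k : ℕ} where

  module _ (label : V → Fin k) (tint : Fin k → Fin 2) where

    ClassEdge : V → V → Set
    ClassEdge u v = label u ≡ label v × hue (tint (label u)) u v ≡ true

  -- A class may be empty; the value of root at it is then irrelevant.
  record Covers (label : V → Fin k) (root : Fin k → V) (tint : Fin k → Fin 2) : Set where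
    field
      rooted : ∀ v → label (root (label v)) ≡ label v
      path   : ∀ v → Star (ClassEdge label tint) (root (label v)) v

CoveredBy : {V : Set} → (Fin 2 → V → V → Bool) → ℕ → Set
CoveredBy {V} hue k = ∃[ label ] ∃[ root ] ∃[ tint ] Covers {V} hue {k} label root tint

∧-intro : ∀ {a b} → a ≡ true → b ≡ true → a ∧ b ≡ true
∧-intro refl refl = refl

∧-elim : ∀ {a b} → a ∧ b ≡ true → a ≡ true × b ≡ true
∧-elim {true} {true} refl = refl , refl

not-true : ∀ {a} → not a ≡ true → a ≡ false
not-true {false} refl = refl

does-true : ∀ {A : Set} (a? : Dec A) → does a? ≡ true → A
does-true (yes a) _ = a

bihue : ∀ {n} → (Fin 2 → Fin n → Fin n → Bool) → Fin 2 → Fin n ⊎ Fin n → Fin n ⊎ Fin n → Bool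
bihue hue c (inj₁ _) (inj₁ _) = false
bihue hue c (inj₁ a) (inj₂ b) = hue c a b
bihue hue c (inj₂ b) (inj₁ a) = hue c a b
bihue hue c (inj₂ _) (inj₂ _) = false

-- The bipartite argument

module Core {n e w : ℕ} (adj : Fin n → Fin n → Bool) (hue : Fin 2 → Fin n → Fin n → Bool)
            (missA : ∀ a → count (λ b → not (adj a b)) ≤ e)
            (missB : ∀ b → count (λ a → not (adj a b)) ≤ e)
            (1≤w : 1 ≤ w) (large : 5 *ℕ e +ℕ 10 *ℕ w ≤ n) (n<2^w : n <ℕ 2 ^ w) where

  open ≤-Reasoning

  -- The colours are parameters, so that the argument can be repeated with their roles exchanged.
  record Palette (k l : Fin 2) : Set where
    field
      full     : ∀ {a b} → adj a b ≡ true → hue k a b ≡ true ⊎ hue l a b ≡ true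
      disjoint : ∀ {a b} → hue k a b ≡ true → hue l a b ≡ false

  -- Common to both cases of the proof: it builds a k-tree at x, an l-tree at y and an l-tree at
  -- some z in the second part.
  module Assemble {k l} (P : Palette k l) (x y : Fin n) (M Ak Al : Fin n → Bool)
                  (covered : ∀ a → Ak a ≡ true ⊎ Al a ≡ true)
                  (x∈Ak : Ak x ≡ true) (x∉Al : Al x ≡ false) where

    open Palette P

    -- Ensures that y falls into the class of which it is the root. It is demanded only once an
    -- element of M enters that class, so the class may also stay empty, as it does when Al is
    -- empty.
    YGood : Set
    YGood = Al y ≡ true × Ak y ≡ false

    side : Bool → Fin 2
    side h = if h then k else l

    Attachable : (Fin n → Bool) → Set
    Attachable h = ∃ λ (m : Fin n → Bool) →
      (∀ a → ∃[ b ] M b ≡ true × m b ≡ h a × hue (side (h a)) a b ≡ true) ×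
      (∀ b → M b ≡ true → m b ≡ true → hue k x b ≡ true) ×
      (∀ b → M b ≡ true → m b ≡ false → hue l y b ≡ true × YGood)

    Nk Nl : Fin n → Fin n → Bool
    Nk b a = hue k a b ∧ Ak a
    Nl b a = hue l a b ∧ Al a

    D : Fin n → Bool
    D a = Ak a ∧ not (Al a)

    Unattached : Fin n → Set
    Unattached b = count (Nk b) <ℕ w × count (Nl b) <ℕ w

    -- L is the set of vertices that may move to the tree at z. `good` is conditional on L having an
    -- element, so an empty third class imposes nothing on z.
    record ThirdTree : Set where
      field
        L    : Fin n → Bool
        z    : Fin n
        L⊆N  : ∀ a → L a ≡ true → hue l a z ≡ true
        L⊆D  : ∀ a → L a ≡ true → D a ≡ true
        x∉L  : L x ≡ false
        good : ∀ a → L a ≡ true → M z ≡ false × Unattached z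
        wide : ∀ b → M b ≡ false → Unattached b → w ≤ count (λ a → hue l a b ∧ L a)

    -- Let b and z both be unattached. Remove from D the vertex x, the at most e non-neighbours of
    -- each, and the fewer than w k-neighbours of each, which count because D lies in Ak. At least w
    -- elements remain, all l-neighbours of both.
    thirdTree : (∀ z → Unattached z → 1 +ℕ (2 *ℕ e +ℕ 3 *ℕ w) ≤ count D) → ThirdTree
    thirdTree big with any? (λ z → (M z ≟ᵇ false) ×-dec ((count (Nk z) ℕ.<? w) ×-dec (count (Nl z) ℕ.<? w)))
    -- Every b outside M can be attached to the first two trees. The third class stays empty and the
    -- index x is a mere default for z.
    ... | no none = record
      { L = const false ; z = x ; L⊆N = λ _ () ; L⊆D = λ _ () ; x∉L = refl ; good = λ _ ()
      ; wide = λ b b∉M un → ⊥-elim (none (b , b∉M , un)) }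
    ... | yes (z , z∉M , unz) = record
      { L = L ; z = z ; L⊆N = λ a p → proj₁ (∧-elim p)
      ; L⊆D = λ a p → proj₁ (∧-elim (proj₂ (∧-elim {hue l a z} p)))
      ; x∉L = x∉L ; good = λ _ _ → z∉M , unz ; wide = λ b _ → wide b }
      where
      L : Fin n → Bool
      -- x is taken out because it has to stay in its own tree as the root.
      L a = hue l a z ∧ (D a ∧ not (does (a ≟ x)))
      x∉L : L x ≡ false
      x∉L rewrite dec-true (x ≟ x) refl with hue l x z | D x
      ... | true  | true  = refl
      ... | true  | false = refl
      ... | false | _     = refl
      module _ (b : Fin n) (unb : Unattached b) where
        sets : List (Fin n → Bool)
        sets = (λ a → hue l a b ∧ L a) ∷ (λ a → not (adj a b)) ∷ (λ a → not (adj a z))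
             ∷ Nk b ∷ Nk z ∷ (λ a → does (a ≟ x)) ∷ []
        cover : ∀ a → D a ≡ true → Any (λ R → R a ≡ true) sets
        cover a a∈D with a∈Ak , a∉Al ← ∧-elim {Ak a} a∈D with adj a b in ab | adj a z in az | does (a ≟ x) in ax
        ... | false | _     | _    = there (here (cong not ab))
        ... | true  | false | _    = there (there (here (cong not az)))
        ... | true  | true  | true = there (there (there (there (there (here ax)))))
        ... | true  | true  | false with full ab | full az
        ...   | inj₁ kb | _       = there (there (there (here (∧-intro kb a∈Ak))))
        ...   | inj₂ lb | inj₁ kz = there (there (there (there (here (∧-intro kz a∈Ak)))))
        ...   | inj₂ lb | inj₂ lz = here (∧-intro lb (∧-intro lz (∧-intro a∈D (cong not ax))))
        wide : w ≤ count (λ a → hue l a b ∧ L a)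
        wide = ℕ.+-cancelʳ-≤ (1 +ℕ (2 *ℕ e +ℕ 2 *ℕ w)) w _ (begin
          w +ℕ (1 +ℕ (2 *ℕ e +ℕ 2 *ℕ w)) ≡⟨ arith e w ⟩
          1 +ℕ (2 *ℕ e +ℕ 3 *ℕ w)        ≤⟨ big z unz ⟩
          count D                        ≤⟨ count-cover sets cover ⟩
          sum (map count sets)
            ≤⟨ ℕ.+-monoʳ-≤ c (ℕ.+-mono-≤ (missB b) (ℕ.+-mono-≤ (missB z) (ℕ.+-mono-≤ (ℕ.<⇒≤ (proj₁ unb))
                 (ℕ.+-mono-≤ (ℕ.<⇒≤ (proj₁ unz)) (ℕ.+-monoˡ-≤ 0 (count-single x)))))) ⟩
          c +ℕ (e +ℕ (e +ℕ (w +ℕ (w +ℕ 1)))) ≡⟨ cong (c +ℕ_) (arith′ e w) ⟩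
          c +ℕ (1 +ℕ (2 *ℕ e +ℕ 2 *ℕ w)) ∎)
          where
          c = count (λ a → hue l a b ∧ L a)
          arith : ∀ e w → w +ℕ (1 +ℕ (2 *ℕ e +ℕ 2 *ℕ w)) ≡ 1 +ℕ (2 *ℕ e +ℕ 3 *ℕ w)
          arith = solve-∀
          arith′ : ∀ e w → e +ℕ (e +ℕ (w +ℕ (w +ℕ 1))) ≡ 1 +ℕ (2 *ℕ e +ℕ 2 *ℕ w)
          arith′ = solve-∀

    module WithThirdTree (third : ThirdTree)
                         (attach : ∀ h → (∀ a → h a ≡ true → Ak a ≡ true) →
                                         (∀ a → h a ≡ false → Al a ≡ true) → Attachable h) where

      open ThirdTree third

      abstract
        k? : ∀ b → Dec (w ≤ count (Nk b))
        k? b = w ℕ.≤? count (Nk b)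

        l? : ∀ b → Dec (w ≤ count (Nl b))
        l? b = w ℕ.≤? count (Nl b)

      -- The variables are the vertices of the first part: true favours the k-tree, false the
      -- l-trees. A vertex of M will be attached through the split of M instead, so its clause is
      -- harmless and only has to be wide.
      clause : Fin n → Clause n
      clause b = if M b then (true , const true)
                 else if does (k? b) then (true , Nk b)
                 else if does (l? b) then (false , Nl b)
                 else (false , λ a → hue l a b ∧ L a)

      clause-wide : ∀ b → w ≤ count (proj₂ (clause b))
      clause-wide b with M b in eqM | k? b | l? b
      ... | true  | _       | _       = begin
        w                      ≤⟨ ℕ.m≤m*n w 10 ⟩
        w *ℕ 10                ≡⟨ ℕ.*-comm w 10 ⟩
        10 *ℕ w                ≤⟨ ℕ.m≤n+m (10 *ℕ w) (5 *ℕ e) ⟩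
        5 *ℕ e +ℕ 10 *ℕ w      ≤⟨ large ⟩
        n                      ≡⟨ sym (count-all n) ⟩
        count {n} (const true) ∎
      ... | false | yes wide′ | _     = wide′
      ... | false | no _  | yes wide′ = wide′
      ... | false | no ¬k | no ¬l     = wide b eqM (ℕ.≰⇒> ¬k , ℕ.≰⇒> ¬l)

      module Assigned (g : Fin n → Bool) (sat : ∀ b → Satisfies g (clause b)) where

        -- A vertex of L with g a = false goes to the tree at z, whatever h says.
        h : Fin n → Bool
        h a = if g a then Ak a else not (Al a)

        -- A vertex in just one of Ak and Al is sent there whatever g says. This keeps the roots x
        -- and y in place.
        h-true : ∀ g {ak al} → ak ≡ true → al ≡ false → (if g then ak else not al) ≡ true
        h-true true  eq _  = eq
        h-true false _  eq = cong not eq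

        h-false : ∀ g {ak al} → ak ≡ false → al ≡ true → (if g then ak else not al) ≡ false
        h-false true  eq _  = eq
        h-false false _  eq = cong not eq

        h⇒Ak : ∀ a → h a ≡ true → Ak a ≡ true
        h⇒Ak a eq with g a | covered a
        ... | true  | _         = eq
        ... | false | inj₁ a∈Ak = a∈Ak
        ... | false | inj₂ a∈Al with () ← trans (sym a∈Al) (not-true eq)

        ¬h⇒Al : ∀ a → h a ≡ false → Al a ≡ true
        ¬h⇒Al a eq with g a | covered a
        ... | true  | inj₁ a∈Ak with () ← trans (sym a∈Ak) eq
        ¬h⇒Al a eq | true  | inj₂ a∈Al = a∈Al
        ¬h⇒Al a eq | false | _ with Al a
        ... | true = refl

        module Labelled (m : Fin n → Bool)
                        (hang : ∀ a → ∃[ b ] M b ≡ true × m b ≡ h a × hue (side (h a)) a b ≡ true)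
                        (m-k : ∀ b → M b ≡ true → m b ≡ true → hue k x b ≡ true)
                        (m-l : ∀ b → M b ≡ true → m b ≡ false → hue l y b ≡ true × YGood) where

          V : Set
          V = Fin n ⊎ Fin n

          choose : Bool → Bool → Fin 3
          choose inL inK = if inL then suc (suc zero) else if inK then zero else suc zero

          label : V → Fin 3
          label (inj₁ a) = choose (L a ∧ not (g a)) (h a)
          label (inj₂ b) = if M b then (if m b then zero else suc zero)
                           else if does (k? b) then zero
                           else if does (l? b) then suc zero
                           else suc (suc zero)

          root : Fin 3 → V
          root zero             = inj₁ x
          root (suc zero)       = inj₁ y
          root (suc (suc zero)) = inj₂ z

          tint : Fin 3 → Fin 2
          tint zero    = k
          tint (suc _) = l

          Edge : V → V → Set
          Edge = ClassEdge (bihue hue) label tint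

          -- Carrying the label of the root along with the path yields both fields of `Covers` at
          -- once, and only nonempty classes have to justify their root.
          record Reached (i : Fin 3) (v : V) : Set where
            constructor reached
            field
              root-label : label (root i) ≡ i
              has-label  : label v ≡ i
              from-root  : Star Edge (root i) v

          at-root : ∀ {i} → label (root i) ≡ i → Reached i (root i)
          at-root eq = reached eq eq ε

          extend : ∀ {i u v} → Reached i u → label v ≡ i → bihue hue (tint i) u v ≡ true → Reached i v
          extend (reached r refl p) eq e = reached r eq (p ◅◅ ((sym eq , e) ◅ ε))

          notL : ∀ a → D a ≡ false → L a ≡ false
          notL a a∉D with L a in eq
          ... | false = refl
          ... | true with () ← trans (sym (L⊆D a eq)) a∉D

          x-start : Reached zero (inj₁ x)
          x-start = at-root eq
            where
            eq : label (inj₁ x) ≡ zero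
            eq = cong₂ choose (cong (_∧ not (g x)) x∉L) (h-true (g x) x∈Ak x∉Al)

          y-start : YGood → Reached (suc zero) (inj₁ y)
          y-start (y∈Al , y∉Ak) = at-root eq
            where
            eq : label (inj₁ y) ≡ suc zero
            eq = cong₂ choose (cong (_∧ not (g y)) (notL y (cong (_∧ not (Al y)) y∉Ak))) (h-false (g y) y∉Ak y∈Al)

          z-start : ∀ a → L a ≡ true → Reached (suc (suc zero)) (inj₂ z)
          z-start a a∈L with z∉M , (¬k , ¬l) ← good a a∈L = at-root eq
            where
            eq : label (inj₂ z) ≡ suc (suc zero)
            eq rewrite z∉M | dec-false (k? z) (ℕ.<⇒≱ ¬k) | dec-false (l? z) (ℕ.<⇒≱ ¬l) = refl

          M-reached₀ : ∀ b → M b ≡ true → m b ≡ true → Reached zero (inj₂ b)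
          M-reached₀ b b∈M mb = extend x-start eq (m-k b b∈M mb)
            where
            eq : label (inj₂ b) ≡ zero
            eq rewrite b∈M | mb = refl

          M-reached₁ : ∀ b → M b ≡ true → m b ≡ false → Reached (suc zero) (inj₂ b)
          M-reached₁ b b∈M mb with yb , ygood ← m-l b b∈M mb = extend (y-start ygood) eq yb
            where
            eq : label (inj₂ b) ≡ suc zero
            eq rewrite b∈M | mb = refl

          A-reached₀ : ∀ a → L a ∧ not (g a) ≡ false → h a ≡ true → Reached zero (inj₁ a)
          A-reached₀ a a∉L ha with hang a
          ... | b , b∈M , mb , ab rewrite ha = extend (M-reached₀ b b∈M mb) eq ab
            where
            eq : label (inj₁ a) ≡ zero
            eq = cong₂ choose a∉L ha

          A-reached₁ : ∀ a → L a ∧ not (g a) ≡ false → h a ≡ false → Reached (suc zero) (inj₁ a)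
          A-reached₁ a a∉L ha with hang a
          ... | b , b∈M , mb , ab rewrite ha = extend (M-reached₁ b b∈M mb) eq ab
            where
            eq : label (inj₁ a) ≡ suc zero
            eq = cong₂ choose a∉L ha

          A-reached₂ : ∀ a → L a ≡ true → g a ≡ false → Reached (suc (suc zero)) (inj₁ a)
          A-reached₂ a a∈L ga = extend (z-start a a∈L) eq (L⊆N a a∈L)
            where
            eq : label (inj₁ a) ≡ suc (suc zero)
            eq rewrite a∈L | ga = refl

          A-reached : ∀ a → ∃[ i ] Reached i (inj₁ a)
          A-reached a with L a ∧ not (g a) in eqL | h a in eqh
          ... | true  | _     = let a∈L , ga = ∧-elim {L a} eqL in _ , A-reached₂ a a∈L (not-true ga)
          ... | false | true  = _ , A-reached₀ a eqL eqh
          ... | false | false = _ , A-reached₁ a eqL eqh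

          -- Outside M, the satisfied clause of b supplies a neighbour a already reached. If `g a`
          -- is true and a is in Ak, then a is in the k-tree. If `g a` is false, then a is in the
          -- tree at z when it lies in L, and in the tree at y when it lies in Al, since Al is
          -- disjoint from D and hence from L.
          B-reached : ∀ b → ∃[ i ] Reached i (inj₂ b)
          B-reached b with M b in eqM | m b in eqm
          ... | true | true  = _ , M-reached₀ b eqM eqm
          ... | true | false = _ , M-reached₁ b eqM eqm
          ... | false | _ with sat b
          ...   | s rewrite eqM with does (k? b) in eqk | does (l? b) in eql
          B-reached b | false | _ | (a , a∈ , ga) | true | _ with ab , a∈Ak ← ∧-elim {hue k a b} a∈ =
            _ , extend (A-reached₀ a (not-in (L a) ga) ha) eq ab
            where
            not-in : ∀ p {q} → q ≡ true → p ∧ not q ≡ false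
            not-in true  refl = refl
            not-in false refl = refl
            ha : h a ≡ true
            ha rewrite ga = a∈Ak
            eq : label (inj₂ b) ≡ zero
            eq rewrite eqM | eqk = refl
          B-reached b | false | _ | (a , a∈ , ga) | false | true with ab , a∈Al ← ∧-elim {hue l a b} a∈ =
            _ , extend (A-reached₁ a (cong (_∧ not (g a)) (notL a a∉D)) ha) eq ab
            where
            a∉D : D a ≡ false
            a∉D rewrite a∈Al with Ak a
            ... | true  = refl
            ... | false = refl
            ha : h a ≡ false
            ha rewrite ga | a∈Al = refl
            eq : label (inj₂ b) ≡ suc zero
            eq rewrite eqM | eqk | eql = refl
          B-reached b | false | _ | (a , a∈ , ga) | false | false with ab , a∈L ← ∧-elim {hue l a b} a∈ =
            _ , extend (A-reached₂ a a∈L ga) eq ab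
            where
            eq : label (inj₂ b) ≡ suc (suc zero)
            eq rewrite eqM | eqk | eql = refl

          all-reached : ∀ v → ∃[ i ] Reached i v
          all-reached (inj₁ a) = A-reached a
          all-reached (inj₂ b) = B-reached b

          covers : Covers (bihue hue) label root tint
          covers = record { rooted = rooted ; path = path }
            where
            rooted : ∀ v → label (root (label v)) ≡ label v
            rooted v with _ , reached r refl _ ← all-reached v = r
            path : ∀ v → Star Edge (root (label v)) v
            path v with _ , reached _ refl p ← all-reached v = p

      result : CoveredBy (bihue hue) 3
      result =
        -- The order matters: g determines h, and only then is M split so as to serve h.
        let g , sat = splitting n<2^w clause clause-wide
            open Assigned g sat
            m , hang , m-k , m-l = attach h h⇒Ak ¬h⇒Al
            open Labelled m hang m-k m-l
        in label , root , tint , covers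

  -- The case of a large common neighbourhood in different colours.

  module Straddled {k l} (P : Palette k l) (x y : Fin n) (M : Fin n → Bool)
                   (M⊆Nx : ∀ b → M b ≡ true → hue k x b ≡ true)
                   (M⊆Ny : ∀ b → M b ≡ true → hue l y b ≡ true)
                   (M-large : e +ℕ 2 *ℕ w ≤ count M) where

    open Palette P

    seen : Fin 2 → Fin n → Fin n → Bool
    seen c a b = hue c a b ∧ M b

    attached : Fin 2 → Fin n → Bool
    attached c a = does (w ℕ.≤? count (seen c a))

    w≤M : w ≤ count M
    w≤M = begin
      w            ≤⟨ ℕ.m≤m+n w (w +ℕ 0) ⟩
      2 *ℕ w       ≤⟨ ℕ.m≤n+m (2 *ℕ w) e ⟩
      e +ℕ 2 *ℕ w  ≤⟨ M-large ⟩
      count M      ∎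

    attached-in : ∀ {c v} → (∀ b → M b ≡ true → hue c v b ≡ true) → attached c v ≡ true
    attached-in M⊆N = dec-true (w ℕ.≤? _) (ℕ.≤-trans w≤M (count-⊆ λ b b∈M → ∧-intro (M⊆N b b∈M) b∈M))

    -- Needs 1 ≤ w, since the empty set would meet a threshold of zero.
    attached-out : ∀ {c v} → (∀ b → M b ≡ true → hue c v b ≡ false) → attached c v ≡ false
    attached-out {c} {v} M∌N = dec-false (w ℕ.≤? _) λ w≤ →
      ℕ.<⇒≱ 1≤w (ℕ.≤-trans w≤ (ℕ.≤-reflexive (count-none none)))
      where
      none : ∀ b → seen c v b ≡ true → ⊥
      none b p = let vb , b∈M = ∧-elim {hue c v b} p in case trans (sym vb) (M∌N b b∈M) of λ ()

    -- Otherwise M would consist of at most e non-neighbours of a and fewer than w neighbours in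
    -- each colour.
    covered : ∀ a → attached k a ≡ true ⊎ attached l a ≡ true
    covered a with w ℕ.≤? count (seen k a) | w ℕ.≤? count (seen l a)
    ... | yes p | _     = inj₁ (dec-true (w ℕ.≤? _) p)
    ... | no _  | yes p = inj₂ (dec-true (w ℕ.≤? _) p)
    ... | no ¬p | no ¬q = ⊥-elim (ℕ.<⇒≱ short M-large)
      where
      sets : List (Fin n → Bool)
      sets = (λ b → not (adj a b)) ∷ seen k a ∷ seen l a ∷ []
      cover : ∀ b → M b ≡ true → Any (λ R → R b ≡ true) sets
      cover b b∈M with adj a b in ab
      ... | false = here (cong not ab)
      ... | true with full ab
      ...   | inj₁ kb = there (here (∧-intro kb b∈M))
      ...   | inj₂ lb = there (there (here (∧-intro lb b∈M)))
      short : count M <ℕ e +ℕ 2 *ℕ w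
      short = begin-strict
        count M               ≤⟨ count-cover sets cover ⟩
        sum (map count sets)  <⟨ ℕ.+-mono-≤-< (missA a) (ℕ.+-mono-< (ℕ.≰⇒> ¬p) (ℕ.+-monoˡ-< 0 (ℕ.≰⇒> ¬q))) ⟩
        e +ℕ 2 *ℕ w           ∎

    open Assemble P x y M (attached k) (attached l) covered
                  (attached-in M⊆Nx) (attached-out λ b b∈M → disjoint (M⊆Nx b b∈M))

    y-good : YGood
    y-good = attached-in M⊆Ny , attached-out λ b b∈M → exclude (M⊆Ny b b∈M)
      where
      exclude : ∀ {b} → hue l y b ≡ true → hue k y b ≡ false
      exclude {b} yb with hue k y b in eq
      ... | false = refl
      ... | true with () ← trans (sym yb) (disjoint eq)

    -- The second split, now with the vertices of M as variables: each a asks for one of its w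
    -- neighbours in the prescribed colour to join its side.
    attach : ∀ h → (∀ a → h a ≡ true → attached k a ≡ true) →
                   (∀ a → h a ≡ false → attached l a ≡ true) → Attachable h
    attach h h⇒k h⇒l =
      let m , sat = splitting n<2^w clause wide
      in m
       , (λ a → let b , p , mb = sat a ; ab , b∈M = ∧-elim {hue (side (h a)) a b} p in b , b∈M , mb , ab)
       , (λ b b∈M _ → M⊆Nx b b∈M)
       , (λ b b∈M _ → M⊆Ny b b∈M , y-good)
      where
      clause : Fin n → Clause n
      clause a = h a , seen (side (h a)) a
      wide : ∀ a → w ≤ count (seen (side (h a)) a)
      wide a with h a in eq
      ... | true  = does-true (w ℕ.≤? _) (h⇒k a eq)
      ... | false = does-true (w ℕ.≤? _) (h⇒l a eq)

    covering : count (λ a → attached l a ∧ not (attached k a)) ≤ count D → CoveredBy (bihue hue) 3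
    covering D-half = WithThirdTree.result (thirdTree big) attach
      where
      -- A neighbour of z attached in both colours lies in `Nk z` or `Nl z`, each smaller than w.
      -- Hence n is at most 2|D| + e + 2w, and n ≥ 5e + 10w gives |D| ≥ 2e + 4w.
      big : ∀ z → Unattached z → 1 +ℕ (2 *ℕ e +ℕ 3 *ℕ w) ≤ count D
      big z (few-k , few-l) = ℕ.*-cancelˡ-≤ 2 (ℕ.+-cancelʳ-≤ (e +ℕ 2 *ℕ w) _ _ (begin
        2 *ℕ (1 +ℕ (2 *ℕ e +ℕ 3 *ℕ w)) +ℕ (e +ℕ 2 *ℕ w)
          ≡⟨ arith₁ e w ⟩
        5 *ℕ e +ℕ 8 *ℕ w +ℕ 2 *ℕ 1
          ≤⟨ ℕ.+-monoʳ-≤ (5 *ℕ e +ℕ 8 *ℕ w) (ℕ.*-monoʳ-≤ 2 1≤w) ⟩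
        5 *ℕ e +ℕ 8 *ℕ w +ℕ 2 *ℕ w
          ≡⟨ arith₂ e w ⟩
        5 *ℕ e +ℕ 10 *ℕ w
          ≤⟨ large ⟩
        n
          ≡⟨ sym (count-all n) ⟩
        count {n} (const true)
          ≤⟨ count-cover sets (λ a _ → cover a) ⟩
        sum (map count sets)
          ≤⟨ ℕ.+-monoʳ-≤ (count D) (ℕ.+-mono-≤ D-half (ℕ.+-mono-≤ (missB z)
               (ℕ.+-mono-≤ (ℕ.<⇒≤ few-k) (ℕ.+-monoˡ-≤ 0 (ℕ.<⇒≤ few-l))))) ⟩
        count D +ℕ (count D +ℕ (e +ℕ (w +ℕ (w +ℕ 0))))
          ≡⟨ arith₃ (count D) e w ⟩
        2 *ℕ count D +ℕ (e +ℕ 2 *ℕ w) ∎))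
        where
        sets : List (Fin n → Bool)
        sets = D ∷ (λ a → attached l a ∧ not (attached k a)) ∷ (λ a → not (adj a z)) ∷ Nk z ∷ Nl z ∷ []
        cover : ∀ a → Any (λ R → R a ≡ true) sets
        cover a with attached k a in eqk | attached l a in eql
        ... | true  | false = here (∧-intro eqk (cong not eql))
        ... | false | true  = there (here (∧-intro eql (cong not eqk)))
        ... | false | false with covered a
        ...   | inj₁ p with () ← trans (sym p) eqk
        ...   | inj₂ p with () ← trans (sym p) eql
        cover a | true  | true  with adj a z in az
        ... | false = there (there (here (cong not az)))
        ... | true with full az
        ...   | inj₁ kz = there (there (there (here (∧-intro kz eqk))))
        ...   | inj₂ lz = there (there (there (there (here (∧-intro lz eql)))))
        arith₁ : ∀ e w → 2 *ℕ (1 +ℕ (2 *ℕ e +ℕ 3 *ℕ w)) +ℕ (e +ℕ 2 *ℕ w) ≡ 5 *ℕ e +ℕ 8 *ℕ w +ℕ 2 *ℕ 1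
        arith₁ = solve-∀
        arith₂ : ∀ e w → 5 *ℕ e +ℕ 8 *ℕ w +ℕ 2 *ℕ w ≡ 5 *ℕ e +ℕ 10 *ℕ w
        arith₂ = solve-∀
        arith₃ : ∀ d e w → d +ℕ (d +ℕ (e +ℕ (w +ℕ (w +ℕ 0)))) ≡ 2 *ℕ d +ℕ (e +ℕ 2 *ℕ w)
        arith₃ = solve-∀

  -- The case where all such common neighbourhoods are small.

  module Uniform {k l} (P : Palette k l) (x : Fin n)
                 (rare : ∀ a → count (λ b → hue k x b ∧ hue l a b) ≤ e +ℕ 2 *ℕ w)
                 (majority : count (hue l x) ≤ count (hue k x)) where

    open Palette P

    M : Fin n → Bool
    M = hue k x

    open Assemble P x x M (const true) (const false) (λ _ → inj₁ refl) refl refl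

    -- The majority colour at x takes at least half of its n - e or more edges.
    M-large : 2 *ℕ e +ℕ 5 *ℕ w ≤ count M
    M-large = ℕ.*-cancelˡ-≤ 2 (ℕ.+-cancelˡ-≤ e _ _ (begin
      e +ℕ 2 *ℕ (2 *ℕ e +ℕ 5 *ℕ w)        ≡⟨ arith₁ e w ⟩
      5 *ℕ e +ℕ 10 *ℕ w                   ≤⟨ large ⟩
      n                                   ≡⟨ sym (count-all n) ⟩
      count {n} (const true)              ≤⟨ count-cover sets (λ b _ → cover b) ⟩
      sum (map count sets)                ≤⟨ ℕ.+-mono-≤ (missA x) (ℕ.+-monoʳ-≤ (count M) (ℕ.+-monoˡ-≤ 0 majority)) ⟩
      e +ℕ 2 *ℕ count M                   ∎))
      where
      sets : List (Fin n → Bool)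
      sets = (λ b → not (adj x b)) ∷ hue k x ∷ hue l x ∷ []
      cover : ∀ b → Any (λ R → R b ≡ true) sets
      cover b with adj x b in xb
      ... | false = here (cong not xb)
      ... | true with full xb
      ...   | inj₁ p = there (here p)
      ...   | inj₂ p = there (there (here p))
      arith₁ : ∀ e w → e +ℕ 2 *ℕ (2 *ℕ e +ℕ 5 *ℕ w) ≡ 5 *ℕ e +ℕ 10 *ℕ w
      arith₁ = solve-∀

    -- Of the 2e + 5w elements of M, at most e are not adjacent to a and at most e + 2w are joined
    -- to it in colour l.
    common : ∀ a → ∃[ b ] M b ∧ hue k a b ≡ true
    common a = count-∃ (ℕ.≤-trans 1≤w (ℕ.+-cancelˡ-≤ (2 *ℕ e +ℕ 2 *ℕ w) _ _ (begin
      2 *ℕ e +ℕ 2 *ℕ w +ℕ w      ≤⟨ ℕ.m≤m+n _ (2 *ℕ w) ⟩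
      2 *ℕ e +ℕ 2 *ℕ w +ℕ w +ℕ 2 *ℕ w ≡⟨ arith₁ e w ⟩
      2 *ℕ e +ℕ 5 *ℕ w           ≤⟨ M-large ⟩
      count M                    ≤⟨ count-cover sets cover ⟩
      sum (map count sets)       ≤⟨ ℕ.+-mono-≤ (missA a) (ℕ.+-monoˡ-≤ _ (rare a)) ⟩
      e +ℕ (e +ℕ 2 *ℕ w +ℕ (c +ℕ 0)) ≡⟨ arith₂ e w c ⟩
      2 *ℕ e +ℕ 2 *ℕ w +ℕ c      ∎)))
      where
      c = count (λ b → M b ∧ hue k a b)
      sets : List (Fin n → Bool)
      sets = (λ b → not (adj a b)) ∷ (λ b → M b ∧ hue l a b) ∷ (λ b → M b ∧ hue k a b) ∷ []
      cover : ∀ b → M b ≡ true → Any (λ R → R b ≡ true) sets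
      cover b b∈M with adj a b in ab
      ... | false = here (cong not ab)
      ... | true with full ab
      ...   | inj₁ p = there (there (here (∧-intro b∈M p)))
      ...   | inj₂ p = there (here (∧-intro b∈M p))
      arith₁ : ∀ e w → 2 *ℕ e +ℕ 2 *ℕ w +ℕ w +ℕ 2 *ℕ w ≡ 2 *ℕ e +ℕ 5 *ℕ w
      arith₁ = solve-∀
      arith₂ : ∀ e w c → e +ℕ (e +ℕ 2 *ℕ w +ℕ (c +ℕ 0)) ≡ 2 *ℕ e +ℕ 2 *ℕ w +ℕ c
      arith₂ = solve-∀

    -- With Al empty, h is constantly true and all of M joins the tree at x, so the class of y stays
    -- empty.
    attach : ∀ h → (∀ a → h a ≡ true → true ≡ true) → (∀ a → h a ≡ false → false ≡ true) → Attachable h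
    attach h _ h-true = const true , hang , (λ b b∈M _ → b∈M) , (λ _ _ ())
      where
      hang : ∀ a → ∃[ b ] M b ≡ true × true ≡ h a × hue (side (h a)) a b ≡ true
      hang a with h a in eq
      ... | false with () ← h-true a eq
      ... | true = let b , p = common a ; b∈M , ab = ∧-elim {M b} p in b , b∈M , refl , ab

    covering : CoveredBy (bihue hue) 3
    covering = WithThirdTree.result (thirdTree λ _ _ → big) attach
      where
      big : 1 +ℕ (2 *ℕ e +ℕ 3 *ℕ w) ≤ count {n} (const true)
      big = begin
        1 +ℕ (2 *ℕ e +ℕ 3 *ℕ w)                          ≤⟨ ℕ.+-monoˡ-≤ _ 1≤w ⟩
        w +ℕ (2 *ℕ e +ℕ 3 *ℕ w)                          ≤⟨ ℕ.m≤m+n _ (3 *ℕ e +ℕ 6 *ℕ w) ⟩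
        w +ℕ (2 *ℕ e +ℕ 3 *ℕ w) +ℕ (3 *ℕ e +ℕ 6 *ℕ w)    ≡⟨ arith e w ⟩
        5 *ℕ e +ℕ 10 *ℕ w                                ≤⟨ large ⟩
        n                                                ≡⟨ sym (count-all n) ⟩
        count {n} (const true)                           ∎
        where
        arith : ∀ e w → w +ℕ (2 *ℕ e +ℕ 3 *ℕ w) +ℕ (3 *ℕ e +ℕ 6 *ℕ w) ≡ 5 *ℕ e +ℕ 10 *ℕ w
        arith = solve-∀

  -- Exchanging the colours together with x and y preserves M, so the larger of the two differences
  -- of Ak and Al can be taken as D.
  straddled : ∀ {k l} → Palette k l → Palette l k → ∀ x y →
              e +ℕ 2 *ℕ w ≤ count (λ b → hue k x b ∧ hue l y b) → CoveredBy (bihue hue) 3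
  straddled {k} {l} P Q x y M-large = by-majority (ℕ.≤-total _ _)
    where
    M : Fin n → Bool
    M b = hue k x b ∧ hue l y b
    M⊆Nx : ∀ b → M b ≡ true → hue k x b ≡ true
    M⊆Nx b = proj₁ ∘ ∧-elim
    M⊆Ny : ∀ b → M b ≡ true → hue l y b ≡ true
    M⊆Ny b = proj₂ ∘ ∧-elim {hue k x b}
    module K = Straddled P x y M M⊆Nx M⊆Ny M-large
    module L = Straddled Q y x M M⊆Ny M⊆Nx M-large
    only : Fin 2 → Fin 2 → ℕ
    only c d = count (λ a → K.attached c a ∧ not (K.attached d a))
    by-majority : only l k ≤ only k l ⊎ only k l ≤ only l k → CoveredBy (bihue hue) 3
    by-majority (inj₁ p) = K.covering p
    by-majority (inj₂ p) = L.covering p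

  covering : ∀ {k l} → Palette k l → Palette l k → Fin n → CoveredBy (bihue hue) 3
  covering {k} {l} P Q x₀
    with any? (λ x → any? λ y → e +ℕ 2 *ℕ w ℕ.≤? count (λ b → hue k x b ∧ hue l y b))
  ... | yes (x , y , M-large) = straddled P Q x y M-large
  ... | no none with ℕ.≤-total (count (hue l x₀)) (count (hue k x₀))
  ...   | inj₁ p = Uniform.covering P x₀ (λ a → ℕ.≰⇒≥ λ q → none (x₀ , a , q)) p
  -- With the colours exchanged, the pair that was ruled out is (a, x₀), with its intersection in
  -- the other order.
  ...   | inj₂ p = Uniform.covering Q x₀ (λ a → ℕ.≤-trans (commute a) (ℕ.≰⇒≥ λ q → none (a , x₀ , q))) p
    where
    commute : ∀ a → count (λ b → hue l x₀ b ∧ hue k a b) ≤ count (λ b → hue k a b ∧ hue l x₀ b)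
    commute a = count-⊆ λ b q → let r , s = ∧-elim {hue l x₀ b} q in ∧-intro s r

-- From monochromatic connected classes to trees

least : ∀ {P : ℕ → Set} → (∀ n → Dec (P n)) → ∀ {n} → P n →
        ∃[ m ] m ≤ n × P m × (∀ j → j <ℕ m → ¬ P j)
least P? {zero}  p = 0 , z≤n , p , λ _ ()
least P? {suc n} p with P? 0
... | yes p₀ = 0 , z≤n , p₀ , λ _ ()
... | no ¬p₀ with m , m≤n , pm , below ← least (P? ∘ suc) p = suc m , s≤s m≤n , pm , below′
  where
  below′ : ∀ j → j <ℕ suc m → ¬ _
  below′ zero    _         = ¬p₀
  below′ (suc j) (s≤s j<m) = below j j<m

enumerate : ∀ {k} {P : Fin k → Set} → (∀ i → Dec (P i)) →
            ∃[ j ] j ≤ k × Σ (Fin j → Fin k) λ e →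
              (∀ i → P (e i)) × (∀ {i i′} → e i ≡ e i′ → i ≡ i′) × (∀ x → P x → ∃[ i ] e i ≡ x)
enumerate {zero}  P? = 0 , z≤n , (λ ()) , (λ ()) , (λ { {()} }) , λ ()
enumerate {suc k} P? with P? zero | enumerate (P? ∘ suc)
... | no ¬p₀ | j , j≤k , e , holds , inj , onto =
  j , ℕ.m≤n⇒m≤1+n j≤k , suc ∘ e , holds , inj ∘ suc-injective , onto′
  where
  onto′ : ∀ x → _ → ∃[ i ] suc (e i) ≡ x
  onto′ zero    p = ⊥-elim (¬p₀ p)
  onto′ (suc x) p = let i , eq = onto x p in i , cong suc eq
... | yes p₀ | j , j≤k , e , holds , inj , onto = suc j , s≤s j≤k , e′ , holds′ , inj′ , onto′
  where
  e′ : Fin (suc j) → Fin (suc k)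
  e′ zero    = zero
  e′ (suc i) = suc (e i)
  holds′ : ∀ i → _
  holds′ zero    = p₀
  holds′ (suc i) = holds i
  inj′ : ∀ {i i′} → e′ i ≡ e′ i′ → i ≡ i′
  inj′ {zero}  {zero}  _  = refl
  inj′ {suc i} {suc _} eq = cong suc (inj (suc-injective eq))
  onto′ : ∀ x → _ → ∃[ i ] e′ i ≡ x
  onto′ zero    _ = zero , refl
  onto′ (suc x) p = let i , eq = onto x p in suc i , cong suc eq

module _ {N : ℕ} {G : SimpleGraph N} (χ : 2-Colouring G) where

  -- A colour exists only on an edge. Abstracting the adjacency bit makes the colour test total,
  -- with value false off the edges.
  hueAt : (b : Bool) → (T b → Fin 2) → Fin 2 → Bool
  hueAt true  f c = does (f _ ≟ c)
  hueAt false f c = false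

  hueOf : Fin 2 → Fin N → Fin N → Bool
  hueOf c u v = hueAt (SimpleGraph.adj G u v) (colour χ {u} {v}) c

  hueOf-elim : ∀ {c u v} → hueOf c u v ≡ true → Σ (Adj G u v) λ e → colour χ e ≡ c
  hueOf-elim {c} {u} {v} = elim (SimpleGraph.adj G u v) (colour χ)
    where
    elim : ∀ b (f : T b → Fin 2) → hueAt b f c ≡ true → Σ (T b) λ e → f e ≡ c
    elim true f eq = _ , does-true (f _ ≟ c) eq

  hueOf-intro : ∀ {c u v} (e : Adj G u v) → colour χ e ≡ c → hueOf c u v ≡ true
  hueOf-intro {c} {u} {v} = intro (SimpleGraph.adj G u v) (colour χ)
    where
    intro : ∀ b (f : T b → Fin 2) (e : T b) → f e ≡ c → hueAt b f c ≡ true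
    intro true f _ eq = dec-true (f _ ≟ c) eq

  hueOf-sym : ∀ {c u v} → hueOf c u v ≡ true → hueOf c v u ≡ true
  hueOf-sym {u = u} {v} p =
    let e , ce = hueOf-elim p ; e′ = subst T (SimpleGraph.symmetric G u v) e
    in hueOf-intro e′ (trans (sym (undirected χ e e′)) ce)

  module _ {k} {label : Fin N → Fin k} {root tint} (cover : Covers hueOf label root tint) where

    open Covers cover

    Edge : Fin N → Fin N → Set
    Edge = ClassEdge hueOf label tint

    -- A walk of exactly d class edges leads to v from the root of its class.
    Within : ℕ → Fin N → Set
    Within zero    v = root (label v) ≡ v
    Within (suc d) v = ∃[ u ] Edge u v × Within d u

    within? : ∀ d v → Dec (Within d v)
    within? zero    v = _ ≟ _
    within? (suc d) v = any? λ u → ((_ ≟ _) ×-dec (_ ≟ᵇ _)) ×-dec within? d u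

    walk : ∀ {d u v} → Within d u → Star Edge u v → ∃[ d′ ] Within d′ v
    walk near ε        = _ , near
    walk near (e ◅ es) = walk {suc _} (_ , e , near) es

    nearest : ∀ v → ∃[ d ] Within d v × (∀ j → j <ℕ d → ¬ Within j v)
    nearest v =
      let _ , near = walk {0} (cong root (rooted v)) (path v)
          d , _ , near′ , below = least (λ d → within? d v) near
      in d , near′ , below

    -- The distance from the root within the class. Parents have smaller rank, so the parent edges
    -- form a breadth-first forest.
    rank : Fin N → ℕ
    rank v = proj₁ (nearest v)

    rank-below : ∀ {d v} → Within d v → rank v ≤ d
    rank-below {v = v} near = ℕ.≮⇒≥ λ d<r → proj₂ (proj₂ (nearest v)) _ d<r near

    climb : ∀ v → root (label v) ≡ v ⊎ ∃[ u ] Edge u v × rank u <ℕ rank v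
    climb v = go (rank v) (proj₁ (proj₂ (nearest v)))
      where
      go : ∀ d → Within d v → root (label v) ≡ v ⊎ ∃[ u ] Edge u v × rank u <ℕ d
      go zero    at-root        = inj₁ at-root
      go (suc d) (u , e , near) = inj₂ (u , e , s≤s (rank-below near))

    parent : Fin N → Maybe (Fin N)
    parent v = [ const nothing , just ∘ proj₁ ]′ (climb v)

    parent-just : ∀ {u v} → parent v ≡ just u → Edge u v × rank u <ℕ rank v
    parent-just {v = v} eq with climb v
    parent-just refl | inj₂ (_ , e , lt) = e , lt

    parent-climbs : ∀ v → root (label v) ≡ v ⊎ ∃[ u ] parent v ≡ just u
    parent-climbs v with climb v
    ... | inj₁ eq      = inj₁ eq
    ... | inj₂ (u , _) = inj₂ (u , refl)

    TreeEdge : Fin N → Fin N → Set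
    TreeEdge u v = parent v ≡ just u ⊎ parent u ≡ just v

    NonBacktracking : List (Fin N) → Set
    NonBacktracking (u ∷ v ∷ w ∷ ws) = u ≢ w × NonBacktracking (v ∷ w ∷ ws)
    NonBacktracking _                = ⊤

    -- A walk that never turns back goes up towards the root for a while and
    -- then only down.
    descend : ∀ {u v} ws {x} → parent v ≡ just u → Linked TreeEdge (v ∷ (ws ∷ʳ x)) →
              NonBacktracking (u ∷ v ∷ (ws ∷ʳ x)) →
              rank v <ℕ rank x × ∃[ p ] p List.∈ (v ∷ ws) × parent x ≡ just p
    descend []       vu (inj₁ xv ∷ _) _         = proj₂ (parent-just xv) , _ , here refl , xv
    descend []       vu (inj₂ vx ∷ _) (u≢x , _) = ⊥-elim (u≢x (just-injective (trans (sym vu) vx)))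
    descend (w ∷ ws) vu (inj₁ wv ∷ l) (_ , nb)  =
      let lt , p , p∈ , xp = descend ws wv l nb in ℕ.<-trans (proj₂ (parent-just wv)) lt , p , there p∈ , xp
    descend (w ∷ ws) vu (inj₂ vw ∷ l) (u≢w , _) = ⊥-elim (u≢w (just-injective (trans (sym vu) vw)))

    -- Either the walk climbs all the way, or it turns down once and then enters x from the parent
    -- of x.
    arrive : ∀ {v} ws {x} → Linked TreeEdge (v ∷ (ws ∷ʳ x)) → NonBacktracking (v ∷ (ws ∷ʳ x)) →
             rank x <ℕ rank v ⊎ ∃[ p ] p List.∈ (v ∷ ws) × parent x ≡ just p
    arrive []       (inj₁ xv ∷ _) _  = inj₂ (_ , here refl , xv)
    arrive []       (inj₂ vx ∷ _) _  = inj₁ (proj₂ (parent-just vx))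
    arrive (w ∷ ws) (inj₁ wv ∷ l) nb =
      let _ , p , p∈ , xp = descend ws wv l nb in inj₂ (p , there p∈ , xp)
    arrive (w ∷ ws) (inj₂ vw ∷ l) nb with arrive ws l (tail-nb ws nb)
      where
      tail-nb : ∀ {v w} ws {x} → NonBacktracking (v ∷ w ∷ (ws ∷ʳ x)) → NonBacktracking (w ∷ (ws ∷ʳ x))
      tail-nb []      (_ , nb) = nb
      tail-nb (_ ∷ _) (_ , nb) = nb
    ... | inj₁ lt            = inj₁ (ℕ.<-trans lt (proj₂ (parent-just vw)))
    ... | inj₂ (p , p∈ , xp) = inj₂ (p , there p∈ , xp)

    unique⇒nonBacktracking : ∀ {v} ws {x} → Unique (v ∷ ws) → All (x ≢_) (v ∷ ws) →
                             NonBacktracking (v ∷ (ws ∷ʳ x))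
    unique⇒nonBacktracking []            _                    _           = tt
    unique⇒nonBacktracking (w ∷ [])      _                    (x≢v ∷ _)   = x≢v ∘ sym , tt
    unique⇒nonBacktracking (w ∷ w′ ∷ ws) ((_ ∷ v≢w′ ∷ _) ∷ uq) (_ ∷ x≢)   =
      v≢w′ , unique⇒nonBacktracking (w′ ∷ ws) uq x≢

    -- A cycle that starts downwards only gains rank and cannot return to x. One that starts upwards
    -- has y as the parent of x; it either only loses rank, or re-enters x from a parent among z and
    -- `vs`, which differs from y.
    no-cycle : ∀ {x y z} vs → Unique (x ∷ y ∷ z ∷ vs) → Linked TreeEdge (x ∷ y ∷ z ∷ (vs ∷ʳ x)) → ⊥
    no-cycle {x} {y} {z} vs ((x≢y ∷ x≢z ∷ x≢vs) ∷ uq@(y≢ ∷ uq′)) (xy ∷ l@(yz ∷ l′)) = go xy yz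
      where
      nb : NonBacktracking (y ∷ z ∷ (vs ∷ʳ x))
      nb = unique⇒nonBacktracking (z ∷ vs) uq (x≢y ∷ x≢z ∷ x≢vs)
      not-parent : ∀ {p} → p List.∈ (z ∷ vs) → parent x ≡ just p → ¬ parent x ≡ just y
      not-parent p∈ xp xy = All.lookup y≢ p∈ (just-injective (trans (sym xy) xp))
      go : TreeEdge x y → TreeEdge y z → ⊥
      go (inj₁ yx) _ =
        let lt , _ = descend (z ∷ vs) yx l (x≢z , nb) in ℕ.<-asym lt (proj₂ (parent-just yx))
      go (inj₂ xy) (inj₁ zy) = let _ , p , p∈ , xp = descend vs zy l′ nb in not-parent p∈ xp xy
      go (inj₂ xy) (inj₂ yz) with arrive vs l′ (unique⇒nonBacktracking vs uq′ (x≢z ∷ x≢vs))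
      ... | inj₁ lt            = ℕ.<-asym lt (ℕ.<-trans (proj₂ (parent-just yz)) (proj₂ (parent-just xy)))
      ... | inj₂ (p , p∈ , xp) = not-parent p∈ xp xy

    EdgeIn : Fin k → Fin N → Fin N → Set
    EdgeIn i u v = (label u ≡ i × label v ≡ i) × TreeEdge u v

    edgeIn? : ∀ i u v → Dec (EdgeIn i u v)
    edgeIn? i u v = ((_ ≟ _) ×-dec (_ ≟ _)) ×-dec (≡-dec _≟_ _ _ ⊎-dec ≡-dec _≟_ _ _)

    edgeIn-sym : ∀ {i u v} → EdgeIn i u v → EdgeIn i v u
    edgeIn-sym ((ui , vi) , e) = (vi , ui) , swap e

    edgeGraph : Fin k → SimpleGraph N
    edgeGraph i = record
      { adj       = λ u v → does (edgeIn? i u v)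
      ; symmetric = λ u v → does-⇔ (mk⇔ edgeIn-sym edgeIn-sym) (edgeIn? i u v) (edgeIn? i v u)
      ; loopless  = λ v → dec-false (edgeIn? i v v) λ
          { (_ , inj₁ vv) → ℕ.<-irrefl refl (proj₂ (parent-just vv))
          ; (_ , inj₂ vv) → ℕ.<-irrefl refl (proj₂ (parent-just vv)) }
      }

    edge-elim : ∀ {i u v} → Adj (edgeGraph i) u v → EdgeIn i u v
    edge-elim {i} {u} {v} t = does-true (edgeIn? i u v) (Equivalence.to T-≡ t)

    edge-intro : ∀ {i u v} → EdgeIn i u v → Adj (edgeGraph i) u v
    edge-intro {i} {u} {v} e = Equivalence.from T-≡ (dec-true (edgeIn? i u v) e)

    edge-hue : ∀ {i u v} → EdgeIn i u v → hueOf (tint i) u v ≡ true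
    edge-hue ((refl , _) , inj₁ vu) = proj₂ (proj₁ (parent-just vu))
    edge-hue {i} {u} {v} ((_ , vi) , inj₂ uv) =
      subst (λ i → hueOf (tint i) u v ≡ true) vi (hueOf-sym (proj₂ (proj₁ (parent-just uv))))

    classSet : Fin k → Subset N
    classSet i = Vec.tabulate λ v → does (label v ≟ i)

    class-intro : ∀ {i v} → label v ≡ i → v ∈ classSet i
    class-intro {i} {v} eq = lookup⇒[]= v _ (trans (lookup∘tabulate _ v) (dec-true (label v ≟ i) eq))

    class-elim : ∀ {i v} → v ∈ classSet i → label v ≡ i
    class-elim {i} {v} v∈ = does-true (label v ≟ i) (trans (sym (lookup∘tabulate _ v)) ([]=⇒lookup v∈))

    class : Fin k → Subgraph G
    class i = record
      { vertices = classSet i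
      ; edges    = edgeGraph i
      ; edges⊆G  = proj₁ ∘ hueOf-elim ∘ edge-hue ∘ edge-elim
      ; ends     = class-intro ∘ proj₁ ∘ proj₁ ∘ edge-elim
      }

    class-monochromatic : ∀ i → Monochromatic χ (class i)
    class-monochromatic i = tint i , λ e → proj₂ (hueOf-elim (edge-hue (edge-elim e)))

    from-root : ∀ d v → rank v <ℕ d → Star (Adj (edgeGraph (label v))) (root (label v)) v
    from-root (suc d) v (s≤s r≤d) with parent-climbs v
    ... | inj₁ eq       = subst (Star _ _) eq ε
    ... | inj₂ (u , vu) with (eq , _) , lt ← parent-just vu =
      subst (λ i → Star (Adj (edgeGraph i)) (root i) u) eq (from-root d u (ℕ.<-≤-trans lt r≤d))
        ◅◅ (edge-intro ((eq , refl) , inj₁ vu) ◅ ε)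

    class-tree : ∀ i → label (root i) ≡ i → IsTree (class i)
    class-tree i eq = record
      { nonempty  = root i , class-intro eq
      ; connected = λ u∈ v∈ → Star.reverse (λ {u} {v} e → edge-intro {i} {v} {u} (edgeIn-sym (edge-elim e))) (to u∈) ◅◅ to v∈
      ; acyclic   = λ { (_ , _ , _ , vs , uq , l) → no-cycle vs uq (Linked.map (proj₂ ∘ edge-elim) l) }
      }
      where
      to : ∀ {v} → v ∈ classSet i → Star (Adj (edgeGraph i)) (root i) v
      to {v} v∈ with refl ← class-elim v∈ = from-root _ v ℕ.≤-refl

    treePartition : TreePartition χ k
    -- By `rooted`, a class is nonempty exactly if it contains its own root. Only these classes
    -- become trees.
    treePartition with j , j≤k , e , used , inj , onto ← enumerate (λ i → label (root i) ≟ i) = record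
      { j             = j
      ; j≤k           = j≤k
      ; part          = class ∘ e
      ; tree          = λ i → class-tree (e i) (used i)
      ; monochromatic = class-monochromatic ∘ e
      ; partition     = λ v → let i , eq = onto (label v) (rooted v) in
          i , class-intro (sym eq) , λ v∈ → inj (trans eq (class-elim v∈))
      }

-- Used to change the vertex type, to recolour, and to replace the data by pointwise equal data.
covers-map : ∀ {V W : Set} {hueV : Fin 2 → V → V → Bool} {hueW : Fin 2 → W → W → Bool} {k}
             {label : V → Fin k} {root tint} → Covers hueV label root tint →
             (φ : V → W) (ψ : W → V) → (∀ w → φ (ψ w) ≡ w) →
             (∀ {c u v} → hueV c u v ≡ true → hueW c (φ u) (φ v) ≡ true) →
             ∀ {label′ root′ tint′} → (∀ v → label′ (φ v) ≡ label v) → (∀ i → root′ i ≡ φ (root i)) →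
             (∀ i → tint′ i ≡ tint i) → Covers hueW label′ root′ tint′
covers-map {hueV = hueV} {hueW} {label = label} {root} {tint} cover φ ψ φψ φ-hue {label′} {root′} {tint′} l≡ r≡ t≡ = record
  { rooted = λ w → subst (λ w → label′ (root′ (label′ w)) ≡ label′ w) (φψ w) (rooted′ (ψ w))
  ; path   = λ w → subst (λ w → Star (ClassEdge hueW label′ tint′) (root′ (label′ w)) w) (φψ w) (path′ (ψ w))
  }
  where
  open Covers cover
  root-label : ∀ v → root′ (label′ (φ v)) ≡ φ (root (label v))
  root-label v = trans (cong root′ (l≡ v)) (r≡ (label v))
  rooted′ : ∀ v → label′ (root′ (label′ (φ v))) ≡ label′ (φ v)
  rooted′ v = trans (cong label′ (root-label v)) (trans (l≡ _) (trans (rooted v) (sym (l≡ v))))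
  φ-edge : ∀ {u v} → ClassEdge hueV label tint u v → ClassEdge hueW label′ tint′ (φ u) (φ v)
  φ-edge {u} {v} (eq , e) =
    trans (l≡ u) (trans eq (sym (l≡ v))) ,
    subst (λ c → hueW c (φ u) (φ v) ≡ true) (sym (trans (cong tint′ (l≡ u)) (t≡ (label u)))) (φ-hue e)
  path′ : ∀ v → Star (ClassEdge hueW label′ tint′) (root′ (label′ (φ v))) (φ v)
  path′ v = subst (λ r → Star _ r (φ v)) (sym (root-label v)) (Star.gmap φ φ-edge (path v))

-- Decidability of AlwaysPartitionable, needed for the minimum in tp₂ to exist

Searchable : Set → Set₁
Searchable A = ∀ {P : A → Set} → (∀ x → Dec (P x)) → Dec (∃ P)

search-Vec : ∀ {A} → Searchable A → ∀ n → Searchable (Vec A n)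
search-Vec search zero    P? = map′ (λ p → [] , p) (λ { ([] , p) → p }) (P? [])
search-Vec search (suc n) P? =
  map′ (λ { (x , xs , p) → x ∷ xs , p }) (λ { (x ∷ xs , p) → x , xs , p })
       (search λ x → search-Vec search n λ xs → P? (x ∷ xs))

module _ {N} {E : Fin N → Fin N → Set} (E? : ∀ u v → Dec (E u v)) (r : Fin N) where

  Explored : (Fin N → Bool) → Set
  Explored S = S r ≡ true × (∀ v → S v ≡ true → Star E r v)

  Closed : (Fin N → Bool) → Set
  Closed S = ∀ {u v} → S u ≡ true → E u v → S v ≡ true

  -- Each round adds a vertex, so fuel plus |S| stays at least N. When the fuel is spent, no vertex
  -- lies outside S.
  explore : ∀ fuel S → N ≤ fuel +ℕ count S → Explored S → ∃[ S′ ] Explored S′ × Closed S′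
  explore fuel S enough (r∈S , reach)
    with any? (λ u → any? λ v → (S u ≟ᵇ true) ×-dec ((S v ≟ᵇ false) ×-dec E? u v))
  ... | no none = S , (r∈S , reach) , λ {u} {v} u∈S e → ¬-not λ v∉S → none (u , v , u∈S , v∉S , e)
  ... | yes (u , v , u∈S , v∉S , e) with fuel
  ...   | zero  = ⊥-elim (ℕ.<⇒≱ (count-⊂ {S = S} {const true} (λ _ _ → refl) v v∉S refl)
                                (ℕ.≤-trans (ℕ.≤-reflexive (count-all N)) enough))
  ...   | suc fuel′ = explore fuel′ S⁺ enough⁺ (⊆⁺ r r∈S , reach⁺)
    where
    S⁺ : Fin N → Bool
    S⁺ w = S w ∨ does (w ≟ v)
    ⊆⁺ : ∀ w → S w ≡ true → S⁺ w ≡ true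
    ⊆⁺ w w∈S rewrite w∈S = refl
    v∈⁺ : S⁺ v ≡ true
    v∈⁺ rewrite v∉S = dec-true (v ≟ v) refl
    enough⁺ : N ≤ fuel′ +ℕ count S⁺
    enough⁺ = ℕ.≤-trans enough (ℕ.≤-trans (ℕ.≤-reflexive (sym (ℕ.+-suc fuel′ _)))
                                          (ℕ.+-monoʳ-≤ fuel′ (count-⊂ ⊆⁺ v v∉S v∈⁺)))
    reach⁺ : ∀ w → S⁺ w ≡ true → Star E r w
    reach⁺ w w∈ with S w in eq
    ... | true  = reach w eq
    ... | false with refl ← does-true (w ≟ v) w∈ = reach u u∈S ◅◅ (e ◅ ε)

  star? : ∀ v → Dec (Star E r v)
  star? v with explore N (λ w → does (w ≟ r)) (ℕ.m≤m+n N _)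
                       (dec-true (r ≟ r) refl , λ w w∈ → subst (Star E r) (sym (does-true (w ≟ r) w∈)) ε)
  ... | S , (r∈S , reach) , closed with S v in eq
  ...   | true  = yes (reach v eq)
  ...   | false = no λ path → case trans (sym eq) (stays r∈S path) of λ ()
    where
    stays : ∀ {u v} → S u ≡ true → Star E u v → S v ≡ true
    stays u∈S ε        = u∈S
    stays u∈S (e ◅ es) = stays (closed u∈S e) es

module _ {N} (hue : Fin 2 → Fin N → Fin N → Bool) where

  covers? : ∀ {k} (label : Fin N → Fin k) root tint → Dec (Covers hue label root tint)
  covers? label root tint =
    map′ (λ f → record { rooted = proj₁ ∘ f ; path = proj₂ ∘ f })
         (λ c v → Covers.rooted c v , Covers.path c v)
         (all? λ v → (_ ≟ _) ×-dec star? (λ u w → (_ ≟ _) ×-dec (_ ≟ᵇ _)) _ v)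

  -- The search runs over vectors, which represent all labels, roots and tints up to pointwise
  -- equality.
  coveredBy? : ∀ k → Dec (CoveredBy hue k)
  coveredBy? k =
    map′ (λ { (l , r , t , c) → lookup l , lookup r , lookup t , c })
         (λ { (l , r , t , c) → Vec.tabulate l , Vec.tabulate r , Vec.tabulate t ,
              covers-map c id id (λ _ → refl) id (lookup∘tabulate l) (lookup∘tabulate r) (lookup∘tabulate t) })
         (search-Vec any? N λ l → search-Vec any? k λ r → search-Vec any? k λ t →
           covers? (lookup l) (lookup r) (lookup t))

  -- Smaller numbers of classes are listed separately because even an empty class needs some vertex
  -- as the value of its root.
  CoveredUpTo : ℕ → Set
  CoveredUpTo k = ∃[ j ] j <ℕ suc k × CoveredBy hue j

  coveredUpTo? : ∀ k → Dec (CoveredUpTo k)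
  coveredUpTo? k = ℕ.anyUpTo? coveredBy? (suc k)

module _ {N} {G : SimpleGraph N} where

  treePartition-mono : ∀ {χ : 2-Colouring G} {j k} → j ≤ k → TreePartition χ j → TreePartition χ k
  treePartition-mono j≤k P = record { TreePartition P ; j≤k = ℕ.≤-trans (TreePartition.j≤k P) j≤k }

  coveredUpTo⇒treePartition : ∀ {χ : 2-Colouring G} {k} → CoveredUpTo (hueOf χ) k → TreePartition χ k
  coveredUpTo⇒treePartition {χ} (j , s≤s j≤k , _ , _ , _ , c) = treePartition-mono j≤k (treePartition χ c)

  -- With the converse above, this reduces the existence of a tree partition to a decidable finite
  -- search.
  treePartition⇒coveredUpTo : ∀ {χ : 2-Colouring G} {k} → TreePartition χ k → CoveredUpTo (hueOf χ) k
  treePartition⇒coveredUpTo {χ} P = j , s≤s j≤k , label , root , tint , record { rooted = rooted ; path = path }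
    where
    open TreePartition P
    label : Fin N → Fin j
    label v = proj₁ (partition v)
    root : Fin j → Fin N
    root i = proj₁ (IsTree.nonempty (tree i))
    tint : Fin j → Fin 2
    tint i = proj₁ (monochromatic i)
    label-≡ : ∀ {i v} → v ∈ vertices (part i) → label v ≡ i
    label-≡ {v = v} v∈ = proj₂ (proj₂ (partition v)) v∈
    root∈ : ∀ i → root i ∈ vertices (part i)
    root∈ i = proj₂ (IsTree.nonempty (tree i))
    rooted : ∀ v → label (root (label v)) ≡ label v
    rooted v = label-≡ (root∈ (label v))
    edge : ∀ {i u v} → Adj (edges (part i)) u v → ClassEdge (hueOf χ) label tint u v
    edge {i} {u} {v} e =
      trans u≡i (sym (label-≡ (ends (part i) (subst T (SimpleGraph.symmetric (edges (part i)) u v) e)))) ,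
      hueOf-intro χ (edges⊆G (part i) e) (trans (proj₂ (monochromatic i) e) (cong tint (sym u≡i)))
      where
      u≡i : label u ≡ i
      u≡i = label-≡ (ends (part i) e)
    path : ∀ v → Star (ClassEdge (hueOf χ) label tint) (root (label v)) v
    path v = Star.map edge (IsTree.connected (tree (label v)) (root∈ _) (proj₁ (proj₂ (partition v))))

  Table : Set
  Table = Vec (Vec (Fin 2) N) N

  -- Reading a table symmetrically makes every table a colouring.
  meet : Fin 2 → Fin 2 → Fin 2
  meet zero    _ = zero
  meet (suc _) d = d

  meet-comm : ∀ c d → meet c d ≡ meet d c
  meet-comm zero       zero       = refl
  meet-comm zero       (suc _)    = refl
  meet-comm (suc _)    zero       = refl
  meet-comm (suc zero) (suc zero) = refl

  meet-idem : ∀ c → meet c c ≡ c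
  meet-idem zero    = refl
  meet-idem (suc _) = refl

  fromTable : Table → 2-Colouring G
  fromTable t = record
    { colour     = λ {u} {v} _ → meet (lookup (lookup t u) v) (lookup (lookup t v) u)
    ; undirected = λ {u} {v} _ _ → meet-comm (lookup (lookup t u) v) _
    }

  -- The value off the edges is a default that never reaches a colouring of `G`.
  colourAt : (b : Bool) → (T b → Fin 2) → Fin 2
  colourAt true  f = f _
  colourAt false f = zero

  colourAt-≡ : ∀ b (f : T b → Fin 2) e → colourAt b f ≡ f e
  colourAt-≡ true f _ = refl

  toTable : 2-Colouring G → Table
  toTable χ = Vec.tabulate λ u → Vec.tabulate λ v → colourAt (SimpleGraph.adj G u v) (colour χ {u} {v})

  lookup-toTable : ∀ χ {u v} (e : Adj G u v) → lookup (lookup (toTable χ) u) v ≡ colour χ e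
  lookup-toTable χ {u} {v} e rewrite lookup∘tabulate (λ u → Vec.tabulate λ v → colourAt (SimpleGraph.adj G u v) (colour χ {u} {v})) u =
    trans (lookup∘tabulate _ v) (colourAt-≡ _ (colour χ) e)

  fromTable-toTable : ∀ χ {u v} (e : Adj G u v) → colour (fromTable (toTable χ)) e ≡ colour χ e
  fromTable-toTable χ {u} {v} e =
    trans (cong₂ meet (lookup-toTable χ e) (trans (lookup-toTable χ e′) (undirected χ e′ e))) (meet-idem _)
    where
    e′ : Adj G v u
    e′ = subst T (SimpleGraph.symmetric G u v) e

  coveredUpTo-recolour : ∀ {χ χ′ : 2-Colouring G} {k} → (∀ {u v} (e : Adj G u v) → colour χ e ≡ colour χ′ e) →
                         CoveredUpTo (hueOf χ) k → CoveredUpTo (hueOf χ′) k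
  coveredUpTo-recolour {χ} {χ′} same (j , j<1+k , label , root , tint , c) = j , j<1+k , label , root , tint ,
    covers-map c id id (λ _ → refl) (λ h → let e , ce = hueOf-elim χ h in hueOf-intro χ′ e (trans (sym (same e)) ce))
      (λ _ → refl) (λ _ → refl) (λ _ → refl)

  -- Every colouring agrees on all edges with one read from a table, so it suffices to search the
  -- finitely many tables for a counterexample.
  alwaysPartitionable? : ∀ k → Dec (AlwaysPartitionable G k)
  alwaysPartitionable? k
    with search-Vec (search-Vec any? N) N (λ t → ¬? (coveredUpTo? (hueOf (fromTable t)) k))
  ... | yes (t , bad) = no λ always → bad (treePartition⇒coveredUpTo (always (fromTable t)))
  ... | no none       = yes λ χ → coveredUpTo⇒treePartition
    (coveredUpTo-recolour {fromTable (toTable χ)} {χ} (fromTable-toTable χ)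
      (decidable-stable (coveredUpTo? (hueOf (fromTable (toTable χ))) k) λ bad → none (toTable χ , bad)))

  tp₂-bound : ∀ {k} → AlwaysPartitionable G k → tp₂[ G ]≤ k
  tp₂-bound always with l , l≤k , partitionable , below ← least alwaysPartitionable? always =
    l , record { partitionable = partitionable ; least = λ m p → ℕ.≮⇒≥ λ m<l → below m m<l p } , l≤k

-- The degree condition

count-+ : ∀ m {n} (S : Fin (m +ℕ n) → Bool) → count S ≡ count (λ i → S (i ↑ˡ n)) +ℕ count (λ i → S (m ↑ʳ i))
count-+ zero    S = refl
count-+ (suc m) S = trans (cong (bit (S zero) +ℕ_) (count-+ m (S ∘ suc))) (sym (ℕ.+-assoc (bit (S zero)) _ _))

count-not : ∀ {n} (S : Fin n → Bool) → count S +ℕ count (not ∘ S) ≡ n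
count-not {zero}  S = refl
count-not {suc n} S with S zero
... | true  = cong suc (count-not (S ∘ suc))
... | false = trans (ℕ.+-suc _ _) (cong suc (count-not (S ∘ suc)))

∣tabulate∣ : ∀ {n} (S : Fin n → Bool) → ∣ Vec.tabulate S ∣ ≡ count S
∣tabulate∣ {zero}  S = refl
∣tabulate∣ {suc n} S with S zero
... | true  = cong suc (∣tabulate∣ (S ∘ suc))
... | false = ∣tabulate∣ (S ∘ suc)

-- As δ is positive, the bound holds with 13/16 alone. In unnormalised rationals the denominators 16
-- and 1 are explicit and can be cross-multiplied.
degree-bound : ∀ {δ} n d → 0ℚ < δ → (+ 13 / 16 + δ) * ℕ→ℚ n ℚ.≤ ℕ→ℚ d → 13 *ℕ n ≤ 16 *ℕ d
degree-bound {δ} n d 0<δ bound = subst (13 *ℕ n ≤_) (ℕ.*-comm d 16) (ℤ.drop‿+≤+ (begin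
  + (13 *ℕ n)                     ≡⟨ ℤ.pos-* 13 n ⟩
  + 13 ℤ.* + n                    ≡⟨ sym (ℤ.*-identityʳ _) ⟩
  + 13 ℤ.* + n ℤ.* + 1            ≤⟨ ℚᵘ.drop-*≤* scaled ⟩
  + d ℤ.* + 16                    ≡⟨ sym (ℤ.pos-* d 16) ⟩
  + (d *ℕ 16)                     ∎))
  where
  open ℤ.≤-Reasoning
  nonNeg : ∀ m → ℚ.NonNegative (ℕ→ℚ m)
  nonNeg m = ℚ.normalize-nonNeg m 1
  ℕ→ℚᵘ : ∀ m → toℚᵘ (ℕ→ℚ m) ℚᵘ.≃ mkℚᵘ (+ m) 0
  ℕ→ℚᵘ m = ℚ.toℚᵘ-fromℚᵘ (mkℚᵘ (+ m) 0)
  lower : + 13 / 16 ℚ.≤ + 13 / 16 + δ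
  lower = subst (ℚ._≤ + 13 / 16 + δ) (ℚ.+-identityʳ (+ 13 / 16)) (ℚ.+-monoʳ-≤ (+ 13 / 16) (ℚ.<⇒≤ 0<δ))
  scaled : mkℚᵘ (+ 13) 15 ℚᵘ.* mkℚᵘ (+ n) 0 ℚᵘ.≤ mkℚᵘ (+ d) 0
  scaled = ℚᵘ.≤-respˡ-≃ (ℚᵘ.≃-trans (ℚ.toℚᵘ-homo-* (+ 13 / 16) (ℕ→ℚ n)) (ℚᵘ.*-congˡ {mkℚᵘ (+ 13) 15} (ℕ→ℚᵘ n)))
            (ℚᵘ.≤-respʳ-≃ (ℕ→ℚᵘ d)
              (ℚ.toℚᵘ-mono-≤ (ℚ.≤-trans (ℚ.*-monoʳ-≤-nonNeg (ℕ→ℚ n) {{nonNeg n}} lower) bound)))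

miss-bound : ∀ {n} (S : Fin n → Bool) → 13 *ℕ n ≤ 16 *ℕ count S → count (not ∘ S) ≤ 3 *ℕ n /ℕ 16
miss-bound {n} S dense = begin
  count (not ∘ S)              ≡⟨ sym (ℕ.m*n/n≡m (count (not ∘ S)) 16) ⟩
  count (not ∘ S) *ℕ 16 /ℕ 16  ≤⟨ ℕ./-monoˡ-≤ 16 few ⟩
  3 *ℕ n /ℕ 16                 ∎
  where
  open ≤-Reasoning
  arith : ∀ c d → 16 *ℕ (c +ℕ d) ≡ 16 *ℕ c +ℕ d *ℕ 16
  arith = solve-∀
  arith′ : ∀ n → 16 *ℕ n ≡ 13 *ℕ n +ℕ 3 *ℕ n
  arith′ = solve-∀
  few : count (not ∘ S) *ℕ 16 ≤ 3 *ℕ n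
  few = ℕ.+-cancelˡ-≤ (13 *ℕ n) _ _ (begin
    13 *ℕ n +ℕ count (not ∘ S) *ℕ 16        ≤⟨ ℕ.+-monoˡ-≤ _ dense ⟩
    16 *ℕ count S +ℕ count (not ∘ S) *ℕ 16  ≡⟨ sym (arith (count S) _) ⟩
    16 *ℕ (count S +ℕ count (not ∘ S))      ≡⟨ cong (16 *ℕ_) (count-not S) ⟩
    16 *ℕ n                                 ≡⟨ arith′ n ⟩
    13 *ℕ n +ℕ 3 *ℕ n                       ∎)

-- For w = 12 + k the left side is 160 (w + 1), which exceeds n when w is the integer quotient of n
-- by 160.
160*[13+k]≤2^[12+k] : ∀ k → 160 *ℕ (13 +ℕ k) ≤ 2 ^ (12 +ℕ k)
160*[13+k]≤2^[12+k] zero    = ℕ.≤ᵇ⇒≤ 2080 4096 _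
160*[13+k]≤2^[12+k] (suc k) = begin
  160 *ℕ (13 +ℕ suc k)                       ≤⟨ ℕ.m≤m+n _ (160 *ℕ (12 +ℕ k)) ⟩
  160 *ℕ (13 +ℕ suc k) +ℕ 160 *ℕ (12 +ℕ k)   ≡⟨ arith k ⟩
  2 *ℕ (160 *ℕ (13 +ℕ k))                    ≤⟨ ℕ.*-monoʳ-≤ 2 (160*[13+k]≤2^[12+k] k) ⟩
  2 *ℕ 2 ^ (12 +ℕ k)                         ≡⟨ cong (2 ^_) (sym (ℕ.+-suc 12 k)) ⟩
  2 ^ (12 +ℕ suc k)                          ∎
  where
  open ≤-Reasoning
  arith : ∀ k → 160 *ℕ (13 +ℕ (1 +ℕ k)) +ℕ 160 *ℕ (12 +ℕ k) ≡ 2 *ℕ (160 *ℕ (13 +ℕ k))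
  arith = solve-∀

-- e ≤ 3n/16 leaves n − 5e ≥ n/16, whence w = n/160; and n < 2 ^ w once w ≥ 12.
module _ {n : ℕ} (1920≤n : 1920 ≤ n) where

  open ≤-Reasoning

  private
    e = 3 *ℕ n /ℕ 16
    w = n /ℕ 160

  12≤w : 12 ≤ w
  12≤w = ℕ./-monoˡ-≤ 160 1920≤n

  large-enough : 5 *ℕ e +ℕ 10 *ℕ w ≤ n
  large-enough = ℕ.*-cancelˡ-≤ 16 (begin
    16 *ℕ (5 *ℕ e +ℕ 10 *ℕ w)      ≡⟨ arith e w ⟩
    5 *ℕ (e *ℕ 16) +ℕ w *ℕ 160     ≤⟨ ℕ.+-mono-≤ (ℕ.*-monoʳ-≤ 5 (ℕ.m/n*n≤m (3 *ℕ n) 16)) (ℕ.m/n*n≤m n 160) ⟩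
    5 *ℕ (3 *ℕ n) +ℕ n             ≡⟨ arith′ n ⟩
    16 *ℕ n                        ∎)
    where
    arith : ∀ e w → 16 *ℕ (5 *ℕ e +ℕ 10 *ℕ w) ≡ 5 *ℕ (e *ℕ 16) +ℕ w *ℕ 160
    arith = solve-∀
    arith′ : ∀ n → 5 *ℕ (3 *ℕ n) +ℕ n ≡ 16 *ℕ n
    arith′ = solve-∀

  few-clauses : n <ℕ 2 ^ w
  few-clauses = begin-strict
    n                               ≡⟨ ℕ.m≡m%n+[m/n]*n n 160 ⟩
    n %ℕ 160 +ℕ w *ℕ 160            <⟨ ℕ.+-monoˡ-< (w *ℕ 160) (ℕ.m%n<n n 160) ⟩
    160 +ℕ w *ℕ 160                 ≡⟨ ℕ.*-comm (suc w) 160 ⟩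
    160 *ℕ suc w                    ≡⟨ cong (λ w → 160 *ℕ suc w) (sym w≡) ⟩
    160 *ℕ (13 +ℕ (w ∸ 12))       ≤⟨ 160*[13+k]≤2^[12+k] (w ∸ 12) ⟩
    2 ^ (12 +ℕ (w ∸ 12))          ≡⟨ cong (2 ^_) w≡ ⟩
    2 ^ w                           ∎
    where
    w≡ : 12 +ℕ (w ∸ 12) ≡ w
    w≡ = ℕ.m+[n∸m]≡n 12≤w

-- Spanning subgraphs of the complete bipartite graph as relations between two parts.

module _ {n : ℕ} (1920≤n : 1920 ≤ n) (G : SimpleGraph (n +ℕ n))
         (bipartite : IsSpanningSubgraph G (completeBipartite n n))
         (dense : ∀ v → 13 *ℕ n ≤ 16 *ℕ degree G v) where

  private
    left right : Fin n → Fin (n +ℕ n)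
    left  a = a ↑ˡ n
    right b = n ↑ʳ b

  crossing : ∀ {u v} → SimpleGraph.adj G u v ≡ true → opposite (splitAt n u) (splitAt n v) ≡ true
  crossing {u} {v} eq = Equivalence.to T-≡ (bipartite {u} {v} (Equivalence.from T-≡ eq))

  degree-left : ∀ a → degree G (left a) ≡ count (λ b → SimpleGraph.adj G (left a) (right b))
  degree-left a = trans (∣tabulate∣ (SimpleGraph.adj G (left a))) (trans (count-+ n _)
    (cong (_+ℕ count (λ b → SimpleGraph.adj G (left a) (right b))) (count-none λ a′ eq → none a′ (crossing {left a} eq))))
    where
    none : ∀ a′ → opposite (splitAt n (left a)) (splitAt n (left a′)) ≡ true → ⊥
    none a′ eq rewrite splitAt-↑ˡ n a n | splitAt-↑ˡ n a′ n with () ← eq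

  degree-right : ∀ b → degree G (right b) ≡ count (λ a → SimpleGraph.adj G (right b) (left a))
  degree-right b = trans (∣tabulate∣ (SimpleGraph.adj G (right b))) (trans (count-+ n _) (trans
    (cong (count (λ a → SimpleGraph.adj G (right b) (left a)) +ℕ_) (count-none λ b′ eq → none b′ (crossing {right b} eq)))
    (ℕ.+-identityʳ _)))
    where
    none : ∀ b′ → opposite (splitAt n (right b)) (splitAt n (right b′)) ≡ true → ⊥
    none b′ eq rewrite splitAt-↑ʳ n n b | splitAt-↑ʳ n n b′ with () ← eq

  module _ (χ : 2-Colouring G) where

    private
      hue : Fin 2 → Fin n → Fin n → Bool
      hue c a b = hueOf χ c (left a) (right b)

      adj : Fin n → Fin n → Bool
      adj a b = SimpleGraph.adj G (left a) (right b)

    missA : ∀ a → count (λ b → not (adj a b)) ≤ 3 *ℕ n /ℕ 16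
    missA a = miss-bound (adj a) (subst (λ d → 13 *ℕ n ≤ 16 *ℕ d) (degree-left a) (dense (left a)))

    missB : ∀ b → count (λ a → not (adj a b)) ≤ 3 *ℕ n /ℕ 16
    missB b = ℕ.≤-trans
      (count-⊆ λ a p → trans (cong not (SimpleGraph.symmetric G (right b) (left a))) p)
      (miss-bound (λ a → SimpleGraph.adj G (right b) (left a))
        (subst (λ d → 13 *ℕ n ≤ 16 *ℕ d) (degree-right b) (dense (right b))))

    private
      module C = Core adj hue missA missB (ℕ.≤-trans (s≤s z≤n) (12≤w 1920≤n)) (large-enough 1920≤n) (few-clauses 1920≤n)

    palette : ∀ {k l} → k ≢ l → (∀ c → c ≡ k ⊎ c ≡ l) → C.Palette k l
    palette {k} {l} k≢l either = record
      { full     = λ p → let e = Equivalence.from T-≡ p in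
          [ (λ eq → inj₁ (hueOf-intro χ e eq)) , (λ eq → inj₂ (hueOf-intro χ e eq)) ]′ (either (colour χ e))
      ; disjoint = λ p → ¬-not λ q → let e , ek = hueOf-elim χ p ; e′ , el = hueOf-elim χ q in
          k≢l (trans (sym ek) (trans (cong (colour χ) (T-irrelevant e e′)) el))
      }

    partitionable : TreePartition χ 3
    partitionable =
      let label , root , tint , c = C.covering (palette {zero} {suc zero} (λ ()) λ { zero → inj₁ refl ; (suc zero) → inj₂ refl })
                                               (palette {suc zero} {zero} (λ ()) λ { zero → inj₂ refl ; (suc zero) → inj₁ refl })
                                               (fromℕ< (ℕ.≤-trans (s≤s z≤n) 1920≤n))
      in treePartition χ (covers-map c (join n n) (splitAt n) (join-splitAt n n) (λ {_} {u} {v} → join-hue u v)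
           {label ∘ splitAt n} {join n n ∘ root} (cong label ∘ splitAt-join n n) (λ _ → refl) (λ _ → refl))
      where
      join-hue : ∀ {c} u v → bihue hue c u v ≡ true → hueOf χ c (join n n u) (join n n v) ≡ true
      join-hue (inj₁ _) (inj₂ _) p = p
      join-hue (inj₂ _) (inj₁ _) p = hueOf-sym χ p

theorem1p8 : ∀ (δ : ℚ) → 0ℚ < δ →
    ∃[ n₀ ] (∀ (n : ℕ) → n₀ ≤ n → (G : SimpleGraph (n +ℕ n)) →
    IsSpanningSubgraph G (completeBipartite n n) →
    MinDegreeAtLeast G ((+ 13 / 16 + δ) * ℕ→ℚ n) →
    tp₂[ G ]≤ 3)
-- 1920 is 12 times 160, the least n whose quotient by 160 reaches 12.
theorem1p8 δ 0<δ = 1920 , λ n 1920≤n G bipartite dense →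
  tp₂-bound (partitionable 1920≤n G bipartite λ v → degree-bound n (degree G v) 0<δ (dense v))
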